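{- For every total Boolean function $f$, with absolute constants hidden in the $O(\cdot)$ (independent of $f$ and of the number of input bits): 1. $\mathsf{MM}(f)^2\leq \mathsf{CG}^{\mathrm{priv}}(f)$; 2. $\mathsf R_0(f)\leq O(\mathsf{CG}^{\mathrm{priv}}(f))$ and $\mathsf{CG}^{\mathrm{priv}}(f)\leq O(\mathsf{EC}(f)^2)$; 3. $\mathsf{CG}^{\mathrm{priv}}(f)\leq O(\mathsf{CG}^{\mathrm{pub}}(f)^2\,\mathsf s(f))$; 4. $\mathsf{CG}^{\mathrm{priv}}(f)\leq \mathsf C^0(f)\,\mathsf C^1(f)$.
   Context: Let $f:\{0,1\}^n\to\{0,1\}$ and $[n]=\{1,\dots,n\}$. Private coin certificate game complexity: $\mathsf{CG}^{\mathrm{priv}}(f)=\min_p\max_{x\in f^{ -1}(0),y\in f^{ -1}(1)}\Big(\sum_{i:x_i\neq y_i}p_{x,i}p_{y,i}\Big)^{ -1}$, where $p=\{p_{x,i}\}$ ranges over nonnegative families with $\sum_{i\in[n]}p_{x,i}=1$ for each input $x$. Public coin certificate game complexity: a deterministic strategy is a pair $(A,B)$ with $A:f^{ -1}(0)\to[n]$, $B:f^{ -1}(1)\to[n]$; it is correct on $(x,y)$ if $A(x)=B(y)=i$ with $x_i\ne y_i$. Then $\mathsf{CG}^{\mathrm{pub}}(f)=\min_{p}\max_{x\in f^{ -1}(0),y\in f^{ -1}(1)}\Big(\sum_{(A,B)\text{ correct on }(x,y)}p_{A,B}\Big)^{ -1}$, with $p$ ranging over probability distributions on pairs $(A,B)$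 of deterministic strategies. Positive adversary (minimax form): $\mathsf{MM}(f)=\min_p\max_{x\in f^{ -1}(0),y\in f^{ -1}(1)}\Big(\sum_{i:x_i\ne y_i}\sqrt{p_{x,i}p_{y,i}}\Big)^{ -1}$, over nonnegative families $p$ with $\sum_i p_{x,i}=1$ for each $x$. $\mathsf R_0(f)$ is the zero-error randomized query complexity: the least, over probability distributions on deterministic decision trees that each compute $f$ correctly on all inputs, of the maximum over inputs of the expected number of queried bits. Expectational certificate complexity: $\mathsf{EC}(f)=\min_w\max_z\sum_i w_{z,i}$ over families $0\le w_{z,i}\le1$ with $\sum_{i:z_i\ne z'_i}w_{z,i}w_{z',i}\ge1$ whenever $f(z)=1-f(z')$. Sensitivity: $\mathsf s(f)=\max_x|\{i: f(x^{(i)})=1-f(x)\}|$, where $x^{(i)}$ is $x$ with the $i$th bit flipped. Certificates: a certificate for $x$ is a partial assignment consistent with $x$ that forces the value of $f$; $\mathsf C(f;x)$ is the least size of a certificate for $x$; $\mathsf C^b(f)=\max_{x\in f^{ -1}(b)}\mathsf C(f;x)$. Conventions: $1/0=+\infty$; a maximum over an empty set (constant $f$) is $0$. -}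

module Defs where

open import Algebra.Bundles using (CommutativeRing)
open import Data.Bool.Base using (Bool; true; false; not; if_then_else_)
import Data.Bool.Properties as Bool
open import Data.Empty using (⊥-elim)
open import Data.Fin.Base using (Fin; zero; suc)
import Data.Fin.Properties as Fin
open import Data.List.Base using (List; []; _∷_; length; filter; allFin; mapMaybe; cartesianProductWith)
import Data.List.Base as List
open import Data.List.Membership.Propositional using (_∈_)
open import Data.List.Membership.Propositional.Properties using (∈-cartesianProductWith⁺)
open import Data.List.Relation.Unary.All as All using (All)
import Data.List.Relation.Unary.All.Properties as All
open import Data.List.Relation.Unary.Any using (here; there)
import Data.List.Extrema
import Data.List.Extrema.Nat as ℕ
open import Data.Maybe.Base using (Maybe; just; nothing; is-just)
open import Data.Nat.Base using (ℕ; zero; suc; NonZero)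
open import Data.Product.Base using (Σ; ∃; _×_; _,_; proj₁; proj₂)
open import Data.Sum.Base using (inj₁; inj₂)
open import Data.Vec.Base using (Vec; []; _∷_; lookup; tabulate; countᵇ; _[_]%=_)
open import Data.Vec.Properties using (tabulate∘lookup; tabulate-cong)
open import Function.Base using (_∘_; _$_; case_of_)
open import Level using (0ℓ)
open import Relation.Binary.Bundles using (DecTotalOrder)
import Relation.Binary.Construct.Add.Supremum.NonStrict as AddSupremum
open import Relation.Binary.Core using (Rel)
open import Relation.Binary.PropositionalEquality as ≡ using (_≡_; _≢_)
import Relation.Binary.Reasoning.Setoid as SetoidReasoning
open import Relation.Binary.Structures using (IsDecTotalOrder)
open import Relation.Nullary using (Dec; yes; no; does; _×-dec_; _→-dec_; ¬?)
import Relation.Nullary.Decidable as Dec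
open import Relation.Nullary.Construct.Add.Supremum using (_⁺; [_]; ⊤⁺)
open import Relation.Unary using (Pred; Satisfiable; _⊆_)

-- The library has no real numbers; ℝ is taken to be an arbitrary complete
-- ordered field, which is unique up to isomorphism.  Decidability of the order
-- and the supremum axiom are classical: they hold of the Dedekind reals under
-- excluded middle.

record CompleteOrderedField : Set₁ where
  field
    commutativeRing : CommutativeRing 0ℓ 0ℓ

  open CommutativeRing commutativeRing public

  infix 4 _≤_
  field
    _≤_             : Rel Carrier 0ℓ
    isDecTotalOrder : IsDecTotalOrder _≈_ _≤_
    0≉1             : 0# ≉ 1#
    inverse         : ∀ x → x ≉ 0# → ∃ λ y → x * y ≈ 1#
    +-monoˡ-≤       : ∀ z {x y} → x ≤ y → x + z ≤ y + z
    *-nonNegative   : ∀ {x y} → 0# ≤ x → 0# ≤ y → 0# ≤ x * y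
    supremum        : (P : Pred Carrier 0ℓ) → Satisfiable P →
                      (∃ λ b → P ⊆ (_≤ b)) →
                      ∃ λ s → P ⊆ (_≤ s) × (∀ b → P ⊆ (_≤ b) → s ≤ b)

  decTotalOrder : DecTotalOrder 0ℓ 0ℓ 0ℓ
  decTotalOrder = record { isDecTotalOrder = isDecTotalOrder }

module RealProperties (ℛ : CompleteOrderedField) where

  open CompleteOrderedField ℛ hiding (zero)
  open DecTotalOrder decTotalOrder public
    using (_≟_; _≤?_)
    renaming ( refl to ≤-refl; reflexive to ≤-reflexive; trans to ≤-trans
             ; antisym to ≤-antisym; total to ≤-total)
  open import Algebra.Properties.Semiring.Sum semiring public
    using (sum; sum-syntax; sum-replicate)
  open import Algebra.Properties.Semiring.Mult semiring public
    using () renaming (_×_ to _·_; ×-assoc-* to ·-assoc-*; ×-congʳ to ·-congʳ)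
  open import Algebra.Properties.Ring ring using (-‿distribʳ-*; -‿involutive)
  open import Algebra.Solver.Ring.NaturalCoefficients.Default commutativeSemiring
  open SetoidReasoning setoid

  fromℕ : ℕ → Carrier
  fromℕ n = n · 1#

  ≤-resp : ∀ {a b c d} → a ≈ b → c ≈ d → a ≤ c → b ≤ d
  ≤-resp a≈b c≈d a≤c =
    ≤-trans (≤-reflexive (sym a≈b)) (≤-trans a≤c (≤-reflexive c≈d))

  +-monoʳ-≤ : ∀ z {x y} → x ≤ y → z + x ≤ z + y
  +-monoʳ-≤ z x≤y = ≤-resp (+-comm _ z) (+-comm _ z) (+-monoˡ-≤ z x≤y)

  +-mono-≤ : ∀ {a b c d} → a ≤ b → c ≤ d → a + c ≤ b + d
  +-mono-≤ a≤b c≤d = ≤-trans (+-monoˡ-≤ _ a≤b) (+-monoʳ-≤ _ c≤d)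

  x+y-x : ∀ x y → x + y - x ≈ y
  x+y-x x y = begin
    x + y - x    ≈⟨ +-congʳ (+-comm x y) ⟩
    y + x - x    ≈⟨ +-assoc y x (- x) ⟩
    y + (x - x)  ≈⟨ +-congˡ (-‿inverseʳ x) ⟩
    y + 0#       ≈⟨ +-identityʳ y ⟩
    y            ∎

  +-cancelˡ-≤ : ∀ z {x y} → z + x ≤ z + y → x ≤ y
  +-cancelˡ-≤ z h = ≤-resp (x+y-x z _) (x+y-x z _) (+-monoˡ-≤ (- z) h)

  x≤y⇒0≤y-x : ∀ {x y} → x ≤ y → 0# ≤ y - x
  x≤y⇒0≤y-x {x} x≤y = ≤-resp (-‿inverseʳ x) refl (+-monoˡ-≤ (- x) x≤y)

  x+[y-x] : ∀ x y → x + (y - x) ≈ y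
  x+[y-x] x y = trans (sym (+-assoc x y (- x))) (x+y-x x y)

  x≤x+y : ∀ {x y} → 0# ≤ y → x ≤ x + y
  x≤x+y {x} 0≤y = ≤-resp (+-identityʳ x) refl (+-monoʳ-≤ x 0≤y)

  0≤+ : ∀ {x y} → 0# ≤ x → 0# ≤ y → 0# ≤ x + y
  0≤+ 0≤x 0≤y = ≤-trans 0≤x (x≤x+y 0≤y)

  0≤1 : 0# ≤ 1#
  0≤1 with ≤-total 0# 1#
  ... | inj₁ h = h
  ... | inj₂ h = ≤-resp refl square (*-nonNegative 0≤-1 0≤-1)
    where
    0≤-1 : 0# ≤ - 1#
    0≤-1 = ≤-resp refl (+-identityˡ (- 1#)) (x≤y⇒0≤y-x h)
    square : - 1# * - 1# ≈ 1#
    square = trans (sym (-‿distribʳ-* (- 1#) 1#))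
                   (trans (-‿cong (*-identityʳ (- 1#))) (-‿involutive 1#))

  *-monoʳ-≤ : ∀ {z x y} → 0# ≤ z → x ≤ y → z * x ≤ z * y
  *-monoʳ-≤ {z} {x} {y} 0≤z x≤y =
    ≤-resp refl eq (x≤x+y (*-nonNegative 0≤z (x≤y⇒0≤y-x x≤y)))
    where
    eq : z * x + z * (y - x) ≈ z * y
    eq = trans (sym (distribˡ z x (y - x))) (*-congˡ (x+[y-x] x y))

  *-monoˡ-≤ : ∀ {z x y} → 0# ≤ z → x ≤ y → x * z ≤ y * z
  *-monoˡ-≤ 0≤z x≤y = ≤-resp (*-comm _ _) (*-comm _ _) (*-monoʳ-≤ 0≤z x≤y)

  inverse-nonNegative : ∀ {x y} → 0# ≤ x → x * y ≈ 1# → 0# ≤ y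
  inverse-nonNegative {x} {y} 0≤x xy≈1 with ≤-total 0# y
  ... | inj₁ h = h
  ... | inj₂ h = ⊥-elim (0≉1 (≤-antisym 0≤1
          (≤-resp xy≈1 (zeroʳ x) (*-monoʳ-≤ 0≤x h))))

  *-≉0 : ∀ {x y} → x ≉ 0# → y ≉ 0# → x * y ≉ 0#
  *-≉0 {x} {y} x≉0 y≉0 xy≈0 = y≉0 (begin
    y              ≈⟨ *-identityˡ y ⟨
    1# * y         ≈⟨ *-congʳ x*x′≈1 ⟨
    (x * x′) * y   ≈⟨ solve 3 (λ a b c → (a :* b) :* c := b :* (a :* c)) refl x x′ y ⟩
    x′ * (x * y)   ≈⟨ *-congˡ xy≈0 ⟩
    x′ * 0#        ≈⟨ zeroʳ x′ ⟩
    0#             ∎)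
    where
    x′ = proj₁ (inverse x x≉0)
    x*x′≈1 = proj₂ (inverse x x≉0)

  invertible⇒≉0 : ∀ {x y} → x * y ≈ 1# → y ≉ 0#
  invertible⇒≉0 {x} xy≈1 y≈0 =
    0≉1 (trans (sym (zeroʳ x)) (trans (*-congˡ (sym y≈0)) xy≈1))

  1≤fromℕ-suc : ∀ n → 1# ≤ fromℕ (suc n)
  1≤fromℕ-suc n = x≤x+y (0≤fromℕ n)
    where
    0≤fromℕ : ∀ n → 0# ≤ fromℕ n
    0≤fromℕ zero    = ≤-refl
    0≤fromℕ (suc n) = 0≤+ 0≤1 (0≤fromℕ n)

  1≤⇒≉0 : ∀ {x} → 1# ≤ x → x ≉ 0#
  1≤⇒≉0 1≤x x≈0 = 0≉1 (≤-antisym 0≤1 (≤-trans 1≤x (≤-reflexive x≈0)))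

  square-cancel-≤ : ∀ {y t} → 0# ≤ y → 0# ≤ t → y * y ≤ t * t → y ≤ t
  square-cancel-≤ {y} {t} 0≤y 0≤t yy≤tt with ≤-total y t
  ... | inj₁ y≤t = y≤t
  ... | inj₂ t≤y with y ≟ 0#
  ...   | yes y≈0 = ≤-trans (≤-reflexive y≈0) 0≤t
  ...   | no  y≉0 = ≤-resp (cancel y) (cancel t)
                      (*-monoʳ-≤ (inverse-nonNegative 0≤y y*y′≈1)
                        (≤-trans yy≤tt (*-monoˡ-≤ 0≤t t≤y)))
    where
    y′ = proj₁ (inverse y y≉0)
    y*y′≈1 = proj₂ (inverse y y≉0)
    cancel : ∀ z → y′ * (y * z) ≈ z
    cancel z = begin
      y′ * (y * z)  ≈⟨ solve 3 (λ a b c → a :* (b :* c) := (b :* a) :* c) refl y′ y z ⟩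
      (y * y′) * z  ≈⟨ *-congʳ y*y′≈1 ⟩
      1# * z        ≈⟨ *-identityˡ z ⟩
      z             ∎

  module Sqrt (x : Carrier) (0≤x : 0# ≤ x) (x≉0 : x ≉ 0#) where

    S : Pred Carrier 0ℓ
    S y = 0# ≤ y × y * y ≤ x

    bound : S ⊆ (_≤ 1# + x)
    bound {y} (0≤y , yy≤x) with ≤-total y 1#
    ... | inj₁ y≤1 = ≤-trans y≤1 (x≤x+y 0≤x)
    ... | inj₂ 1≤y = ≤-trans (≤-resp (*-identityˡ y) refl (*-monoˡ-≤ 0≤y 1≤y))
                       (≤-trans yy≤x (≤-resp refl (+-comm x 1#) (x≤x+y 0≤1)))

    0∈S : S 0#
    0∈S = ≤-refl , ≤-trans (≤-reflexive (zeroˡ 0#)) 0≤x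

    sup = supremum S (0# , 0∈S) (1# + x , bound)

    s : Carrier
    s = proj₁ sup

    S≤s : S ⊆ (_≤ s)
    S≤s = proj₁ (proj₂ sup)

    0≤s : 0# ≤ s
    0≤s = S≤s 0∈S

    s≉0 : s ≉ 0#
    s≉0 s≈0 with ≤-total x 1#
    ... | inj₁ x≤1 = x≉0 (≤-antisym (≤-trans (S≤s (0≤x , xx≤x)) (≤-reflexive s≈0)) 0≤x)
      where
      xx≤x : x * x ≤ x
      xx≤x = ≤-resp refl (*-identityʳ x) (*-monoʳ-≤ 0≤x x≤1)
    ... | inj₂ 1≤x = 1≤⇒≉0 (S≤s (0≤1 , ≤-trans (≤-reflexive (*-identityˡ 1#)) 1≤x)) s≈0

    s′ = proj₁ (inverse s s≉0)
    s*s′≈1 = proj₂ (inverse s s≉0)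

    0≤s′ : 0# ≤ s′
    0≤s′ = inverse-nonNegative 0≤s s*s′≈1

    2≉0 : 1# + 1# ≉ 0#
    2≉0 = 1≤⇒≉0 (x≤x+y 0≤1)

    h = proj₁ (inverse (1# + 1#) 2≉0)

    h+h≈1 : h + h ≈ 1#
    h+h≈1 = trans (+-cong (sym (*-identityˡ h)) (sym (*-identityˡ h)))
                  (trans (sym (distribʳ h 1# 1#)) (proj₂ (inverse (1# + 1#) 2≉0)))

    0≤h : 0# ≤ h
    0≤h = inverse-nonNegative (0≤+ 0≤1 0≤1) (proj₂ (inverse (1# + 1#) 2≉0))

    double : ∀ z → h * z + h * z ≈ z
    double z = trans (sym (distribʳ z h h)) (trans (*-congʳ h+h≈1) (*-identityˡ z))

    k : Carrier
    k = x * s′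

    s*k≈x : s * k ≈ x
    s*k≈x = begin
      s * (x * s′)  ≈⟨ solve 3 (λ a b c → a :* (b :* c) := b :* (a :* c)) refl s x s′ ⟩
      x * (s * s′)  ≈⟨ *-congˡ s*s′≈1 ⟩
      x * 1#        ≈⟨ *-identityʳ x ⟩
      x             ∎

    amgm′ : ∀ {a b} → a ≤ b → a * b ≤ (h * (a + b)) * (h * (a + b))
    amgm′ {a} {b} a≤b = ≤-resp refl eq (x≤x+y (*-nonNegative 0≤hd 0≤hd))
      where
      d = b - a
      0≤hd : 0# ≤ h * d
      0≤hd = *-nonNegative 0≤h (x≤y⇒0≤y-x a≤b)
      a+d≈b : a + d ≈ b
      a+d≈b = x+[y-x] a b
      eq : a * b + (h * d) * (h * d) ≈ (h * (a + b)) * (h * (a + b))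
      eq = begin
        a * b + (h * d) * (h * d)
          ≈⟨ +-congʳ (*-congˡ a+d≈b) ⟨
        a * (a + d) + (h * d) * (h * d)
          ≈⟨ +-congʳ (trans (*-congʳ (trans (*-cong h+h≈1 h+h≈1) (*-identityˡ 1#))) (*-identityˡ _)) ⟨
        ((h + h) * (h + h)) * (a * (a + d)) + (h * d) * (h * d)
          ≈⟨ solve 3 (λ u v w →
               ((u :+ u) :* (u :+ u)) :* (v :* (v :+ w)) :+ (u :* w) :* (u :* w)
               := (u :* (v :+ (v :+ w))) :* (u :* (v :+ (v :+ w)))) refl h a d ⟩
        (h * (a + (a + d))) * (h * (a + (a + d)))
          ≈⟨ *-cong h[a+b] h[a+b] ⟩
        (h * (a + b)) * (h * (a + b)) ∎
        where
        h[a+b] : h * (a + (a + d)) ≈ h * (a + b)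
        h[a+b] = *-congˡ (+-congˡ a+d≈b)

    t : Carrier
    t = h * (s + k)

    x≤t*t : x ≤ t * t
    x≤t*t with ≤-total s k
    ... | inj₁ s≤k = ≤-resp s*k≈x refl (amgm′ s≤k)
    ... | inj₂ k≤s = ≤-resp (trans (*-comm k s) s*k≈x)
                            (*-cong (*-congˡ (+-comm k s)) (*-congˡ (+-comm k s)))
                            (amgm′ k≤s)

    0≤t : 0# ≤ t
    0≤t = *-nonNegative 0≤h (0≤+ 0≤s (*-nonNegative 0≤x 0≤s′))

    s≤t : s ≤ t
    s≤t = proj₂ (proj₂ sup) t λ (0≤y , yy≤x) →
      square-cancel-≤ 0≤y 0≤t (≤-trans yy≤x x≤t*t)

    s*s≤x : s * s ≤ x
    s*s≤x = ≤-resp refl s*k≈x (*-monoʳ-≤ 0≤s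
      (+-cancelˡ-≤ s (≤-resp refl (double (s + k)) (+-mono-≤ s≤t s≤t))))

    t≉0 : t ≉ 0#
    t≉0 t≈0 = s≉0 (≤-antisym (≤-trans s≤t (≤-reflexive t≈0)) 0≤s)

    t′ = proj₁ (inverse t t≉0)
    t*t′≈1 = proj₂ (inverse t t≉0)

    0≤t′ : 0# ≤ t′
    0≤t′ = inverse-nonNegative 0≤t t*t′≈1

    u : Carrier
    u = x * t′

    u≤t : u ≤ t
    u≤t = ≤-resp refl
      (trans (*-assoc t t t′) (trans (*-congˡ t*t′≈1) (*-identityʳ t)))
      (*-monoˡ-≤ 0≤t′ x≤t*t)

    u*t≈x : u * t ≈ x
    u*t≈x = trans (*-assoc x t′ t)
      (trans (*-congˡ (trans (*-comm t′ t) t*t′≈1)) (*-identityʳ x))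

    0≤u : 0# ≤ u
    0≤u = *-nonNegative 0≤x 0≤t′

    x≤s*s : x ≤ s * s
    x≤s*s = +-cancelˡ-≤ x (≤-resp refl eq (+-mono-≤ x≤s*t x≤s*t))
      where
      x≤s*t : x ≤ s * t
      x≤s*t = ≤-resp u*t≈x refl
        (*-monoˡ-≤ 0≤t (S≤s (0≤u , ≤-resp refl u*t≈x (*-monoʳ-≤ 0≤u u≤t))))
      eq : s * t + s * t ≈ x + s * s
      eq = begin
        s * t + s * t      ≈⟨ distribˡ s t t ⟨
        s * (t + t)        ≈⟨ *-congˡ (double (s + k)) ⟩
        s * (s + k)        ≈⟨ distribˡ s s k ⟩
        s * s + s * k      ≈⟨ +-congˡ s*k≈x ⟩
        s * s + x          ≈⟨ +-comm (s * s) x ⟩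
        x + s * s          ∎

  squareRoot : ∀ x → 0# ≤ x → ∃ λ r → 0# ≤ r × r * r ≈ x
  squareRoot x 0≤x with x ≟ 0#
  ... | yes x≈0 = 0# , ≤-refl , trans (zeroˡ 0#) (sym x≈0)
  ... | no  x≉0 = Sqrt.s x 0≤x x≉0 , Sqrt.0≤s x 0≤x x≉0 ,
                  ≤-antisym (Sqrt.s*s≤x x 0≤x x≉0) (Sqrt.x≤s*s x 0≤x x≉0)

  √ : ∀ x → 0# ≤ x → Carrier
  √ x 0≤x = proj₁ (squareRoot x 0≤x)

  √-≉0 : ∀ {x} 0≤x → x ≉ 0# → √ x 0≤x ≉ 0#
  √-≉0 {x} 0≤x x≉0 r≈0 = x≉0 (begin
    x                        ≈⟨ proj₂ (proj₂ (squareRoot x 0≤x)) ⟨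
    √ x 0≤x * √ x 0≤x        ≈⟨ *-cong r≈0 r≈0 ⟩
    0# * 0#                  ≈⟨ zeroˡ 0# ⟩
    0#                       ∎)

  sum-nonNegative : ∀ {n} {v : Fin n → Carrier} → (∀ i → 0# ≤ v i) → 0# ≤ sum v
  sum-nonNegative {zero}  0≤v = ≤-refl
  sum-nonNegative {suc n} 0≤v = 0≤+ (0≤v zero) (sum-nonNegative (0≤v ∘ suc))

  term≤sum : ∀ {n} {v : Fin n → Carrier} → (∀ i → 0# ≤ v i) → ∀ i → v i ≤ sum v
  term≤sum 0≤v zero    = x≤x+y (sum-nonNegative (0≤v ∘ suc))
  term≤sum 0≤v (suc i) = ≤-trans (term≤sum (0≤v ∘ suc) i)
    (≤-resp refl (+-comm _ _) (x≤x+y (0≤v zero)))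

  filteredSum : ∀ {m} {P : Pred (Fin m) 0ℓ} → (∀ i → Dec (P i)) → (Fin m → Carrier) → Carrier
  filteredSum {m} P? v = ∑[ i < m ] (if does (P? i) then v i else 0#)

  term≤filteredSum : ∀ {m} {P : Pred (Fin m) 0ℓ} (P? : ∀ i → Dec (P i)) (v : Fin m → Carrier) →
                     (∀ i → 0# ≤ v i) → ∀ i → P i →
                     v i ≤ filteredSum P? v
  term≤filteredSum P? v 0≤v i Pi = ≤-trans
    (≡.subst (λ b → v i ≤ (if b then v i else 0#)) (≡.sym (Dec.dec-true (P? i) Pi)) ≤-refl)
    (term≤sum 0≤term i)
    where
    0≤term : ∀ j → 0# ≤ (if does (P? j) then v j else 0#)
    0≤term j with does (P? j)
    ... | true  = 0≤v j
    ... | false = ≤-refl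

  filteredSum-≉0 : ∀ {m} {P : Pred (Fin m) 0ℓ} (P? : ∀ i → Dec (P i)) (v : Fin m → Carrier) →
                   (∀ i → 0# ≤ v i) → ∀ i → P i → v i ≉ 0# →
                   filteredSum P? v ≉ 0#
  filteredSum-≉0 P? v 0≤v i Pi vi≉0 sum≈0 = vi≉0 (≤-antisym
    (≤-trans (term≤filteredSum P? v 0≤v i Pi) (≤-reflexive sum≈0)) (0≤v i))

  -- The values of interest lie in [0,+∞], with ⊤⁺ as +∞.

  ℝ⁺ : Set
  ℝ⁺ = Carrier ⁺

  open AddSupremum _≤_ public

  decTotalOrder⁺ : DecTotalOrder 0ℓ 0ℓ 0ℓ
  decTotalOrder⁺ = record { isDecTotalOrder = ≤⁺-isDecTotalOrder isDecTotalOrder }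

  module Extrema⁺ = Data.List.Extrema (DecTotalOrder.totalOrder decTotalOrder⁺)

  -- Only used on nonnegative values, so that the maximum of [] is 0.
  max⁺ : List ℝ⁺ → ℝ⁺
  max⁺ = Extrema⁺.max [ 0# ]

  recip⁺ : Carrier → ℝ⁺
  recip⁺ x with x ≟ 0#
  ... | yes _   = ⊤⁺
  ... | no  x≉0 = [ proj₁ (inverse x x≉0) ]

  Finite : ℝ⁺ → Set
  Finite v = ∃ λ r → v ≡ [ r ]

  recip⁺-finite : ∀ {x} → x ≉ 0# → Finite (recip⁺ x)
  recip⁺-finite {x} x≉0 with x ≟ 0#
  ... | yes x≈0 = ⊥-elim (x≉0 x≈0)
  ... | no  x≉0 = _ , ≡.refl

  max⁺-finite : ∀ xs → All Finite xs → Finite (max⁺ xs)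
  max⁺-finite xs = Extrema⁺.argmax-all (λ v → v) {xs = xs} (0# , ≡.refl)

  0≤max⁺ : ∀ xs → [ 0# ] ≤⁺ max⁺ xs
  0≤max⁺ xs = Extrema⁺.v≤max⁺ [ 0# ] xs (inj₁ [ ≤-refl ])

  -- The infimum of a family in [0,+∞], as the supremum of its lower bounds; it
  -- is real since some member of the family is finite.  The minimum over
  -- strategies in each complexity measure is expressed by this infimum, with
  -- which it coincides because it is attained.

  infimum : {I : Set} (v : I → ℝ⁺) → (∀ i → [ 0# ] ≤⁺ v i) → (∃ λ i → Finite (v i)) → Carrier
  infimum v 0≤v (i , r , vi≡r) = proj₁ $
    supremum (λ l → ∀ j → [ l ] ≤⁺ v j) (0# , 0≤v)
      (r , λ {l} l≤v → [≤]-injective (≡.subst ([ l ] ≤⁺_) vi≡r (l≤v i)))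

Input : ℕ → Set
Input n = Vec Bool n

BoolFun : ℕ → Set
BoolFun n = Input n → Bool

inputs : ∀ n → List (Input n)
inputs zero    = [] ∷ []
inputs (suc n) = cartesianProductWith _∷_ (false ∷ true ∷ []) (inputs n)

∈-inputs : ∀ {n} (x : Input n) → x ∈ inputs n
∈-inputs []      = here ≡.refl
∈-inputs (b ∷ x) = ∈-cartesianProductWith⁺ _∷_ (∈-bools b) (∈-inputs x)
  where
  ∈-bools : ∀ b → b ∈ false ∷ true ∷ []
  ∈-bools false = here ≡.refl
  ∈-bools true  = there (here ≡.refl)

_⁻¹[_] : ∀ {n} → BoolFun n → Bool → Set
f ⁻¹[ b ] = ∃ λ x → f x ≡ b

inPreimage? : ∀ {n} (f : BoolFun n) b → Input n → Maybe (f ⁻¹[ b ])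
inPreimage? f b x with f x Bool.≟ b
... | yes fx≡b = just (x , fx≡b)
... | no  _    = nothing

preimage : ∀ {n} (f : BoolFun n) b → List (f ⁻¹[ b ])
preimage {n} f b = mapMaybe (inPreimage? f b) (inputs n)

Differ : ∀ {n} → Input n → Input n → Pred (Fin n) 0ℓ
Differ x y i = lookup x i ≢ lookup y i

differ? : ∀ {n} (x y : Input n) i → Dec (Differ x y i)
differ? x y i = ¬? (lookup x i Bool.≟ lookup y i)

sensitivityAt : ∀ {n} → BoolFun n → Input n → ℕ
sensitivityAt {n} f x =
  length (filter (λ i → f (x [ i ]%= not) Bool.≟ not (f x)) (allFin n))

sensitivity : ∀ {n} → BoolFun n → ℕ
sensitivity {n} f = ℕ.max 0 (List.map (sensitivityAt f) (inputs n))

PartialAssignment : ℕ → Set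
PartialAssignment n = Vec (Maybe Bool) n

partialAssignments : ∀ n → List (PartialAssignment n)
partialAssignments zero    = [] ∷ []
partialAssignments (suc n) =
  cartesianProductWith _∷_ (nothing ∷ just false ∷ just true ∷ []) (partialAssignments n)

size : ∀ {n} → PartialAssignment n → ℕ
size = countᵇ is-just

Consistent : ∀ {n} → PartialAssignment n → Pred (Input n) 0ℓ
Consistent ρ x = ∀ i b → lookup ρ i ≡ just b → lookup x i ≡ b

IsCertificate : ∀ {n} → BoolFun n → Input n → Pred (PartialAssignment n) 0ℓ
IsCertificate f x ρ = Consistent ρ x × (∀ z → Consistent ρ z → f z ≡ f x)

consistent? : ∀ {n} (ρ : PartialAssignment n) x → Dec (Consistent ρ x)
consistent? ρ x = Fin.all? λ i → agree? (lookup ρ i) (lookup x i)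
  where
  agree? : ∀ m c → Dec (∀ b → m ≡ just b → c ≡ b)
  agree? nothing  c = yes λ _ ()
  agree? (just b) c = Dec.map′ (λ { c≡b _ ≡.refl → c≡b }) (λ h → h b ≡.refl) (c Bool.≟ b)

isCertificate? : ∀ {n} (f : BoolFun n) x ρ → Dec (IsCertificate f x ρ)
isCertificate? {n} f x ρ = consistent? ρ x ×-dec
  Dec.map′ (λ h z → All.lookup h (∈-inputs z)) (λ h → All.tabulate λ {z} _ → h z)
    (All.all? (λ z → consistent? ρ z →-dec f z Bool.≟ f x) (inputs n))

-- The starting value n is harmless: assigning all n bits of x is a certificate.
C[_]at : ∀ {n} → BoolFun n → Input n → ℕ
C[_]at {n} f x = ℕ.min n (List.map size (filter (isCertificate? f x) (partialAssignments n)))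

certificateComplexity : ∀ {n} → Bool → BoolFun n → ℕ
certificateComplexity b f = ℕ.max 0 (List.map (C[ f ]at ∘ proj₁) (preimage f b))

data DecisionTree (n : ℕ) : Set where
  leaf : Bool → DecisionTree n
  node : Fin n → DecisionTree n → DecisionTree n → DecisionTree n

eval : ∀ {n} → DecisionTree n → BoolFun n
eval (leaf b)       x = b
eval (node i t₀ t₁) x = if lookup x i then eval t₁ x else eval t₀ x

-- Querying a bit again is permitted and counted again, which never helps.
queries : ∀ {n} → DecisionTree n → Input n → ℕ
queries (leaf b)       x = 0
queries (node i t₀ t₁) x = suc (if lookup x i then queries t₁ x else queries t₀ x)

TreeFor : ∀ {n} → BoolFun n → Set
TreeFor {n} f = Σ (DecisionTree n) λ t → ∀ x → eval t x ≡ f x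

fullTree : ∀ {n} (f : BoolFun n) → TreeFor f
fullTree {zero}  f = leaf (f []) , λ { [] → ≡.refl }
fullTree {suc n} f = node zero (shift (proj₁ t₀)) (shift (proj₁ t₁)) , correct
  where
  t₀ = fullTree (f ∘ (false ∷_))
  t₁ = fullTree (f ∘ (true ∷_))
  shift : DecisionTree n → DecisionTree (suc n)
  shift (leaf b)     = leaf b
  shift (node i l r) = node (suc i) (shift l) (shift r)
  eval-shift : ∀ t b x → eval (shift t) (b ∷ x) ≡ eval t x
  eval-shift (leaf _)     b x = ≡.refl
  eval-shift (node i l r) b x
    rewrite eval-shift l b x | eval-shift r b x = ≡.refl
  correct : ∀ x → eval (node zero (shift (proj₁ t₀)) (shift (proj₁ t₁))) x ≡ f x
  correct (false ∷ x) = ≡.trans (eval-shift (proj₁ t₀) false x) (proj₂ t₀ x)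
  correct (true  ∷ x) = ≡.trans (eval-shift (proj₁ t₁) true  x) (proj₂ t₁ x)

module Measures (ℛ : CompleteOrderedField) where

  open CompleteOrderedField ℛ hiding (zero)
  open RealProperties ℛ

  record Distribution (n : ℕ) : Set where
    field
      prob        : Fin n → Carrier
      nonNegative : ∀ i → 0# ≤ prob i
      total       : sum prob ≈ 1#

  open Distribution

  -- A finitely supported probability distribution on A, whose listed outcomes
  -- need not be distinct.
  record Random (A : Set) : Set where
    field
      {support} : ℕ
      law       : Distribution support
      outcome   : Fin support → A

  open Random

  probability : ∀ {A : Set} (X : Random A) {P : Pred A 0ℓ} → (∀ a → Dec (P a)) → Carrier
  probability X P? = filteredSum (λ k → P? (outcome X k)) (prob (law X))

  expectation : ∀ {A : Set} → Random A → (A → Carrier) → Carrier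
  expectation X g = ∑[ k < support X ] (prob (law X) k * g (outcome X k))

  uniform : ∀ n → .{{_ : NonZero n}} → Distribution n
  uniform (suc n) = record
    { prob        = λ _ → u
    ; nonNegative = λ _ → 0≤u
    ; total       = trans (sum-replicate (suc n)) (trans n·u≈ n*u≈1)
    }
    where
    n≉0 : fromℕ (suc n) ≉ 0#
    n≉0 = 1≤⇒≉0 (1≤fromℕ-suc n)
    u = proj₁ (inverse (fromℕ (suc n)) n≉0)
    n*u≈1 = proj₂ (inverse (fromℕ (suc n)) n≉0)
    0≤u : 0# ≤ u
    0≤u = inverse-nonNegative (≤-trans 0≤1 (1≤fromℕ-suc n)) n*u≈1
    n·u≈ : suc n · u ≈ fromℕ (suc n) * u
    n·u≈ = sym (trans (·-assoc-* (suc n) 1# u) (·-congʳ (suc n) (*-identityˡ u)))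

  uniform-≉0 : ∀ n .{{_ : NonZero n}} i → prob (uniform n) i ≉ 0#
  uniform-≉0 (suc n) i =
    invertible⇒≉0 (proj₂ (inverse (fromℕ (suc n)) (1≤⇒≉0 (1≤fromℕ-suc n))))

  module _ {n : ℕ} where

    sumDiffer : Input n → Input n → (Fin n → Carrier) → Carrier
    sumDiffer x y v = filteredSum (differ? x y) v

    module _ (f : BoolFun n) (s : f ⁻¹[ false ] → f ⁻¹[ true ] → Carrier) where

      inverses : List ℝ⁺
      inverses = cartesianProductWith (λ x y → recip⁺ (s x y)) (preimage f false) (preimage f true)

      worstInverse : ℝ⁺
      worstInverse = max⁺ inverses

      0≤worstInverse : [ 0# ] ≤⁺ worstInverse
      0≤worstInverse = 0≤max⁺ inverses

      worstInverse-finite : (∀ x y → s x y ≉ 0#) → Finite worstInverse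
      worstInverse-finite s≉0 = max⁺-finite inverses
        (All.cartesianProductWith⁺ (≡.setoid _) (≡.setoid _) (λ x y → recip⁺ (s x y))
          (preimage f false) (preimage f true)
          (λ {x} {y} _ _ → recip⁺-finite (s≉0 x y)))

    separated : ∀ (f : BoolFun n) {x y} → f x ≢ f y → ∃ (Differ x y)
    separated f {x} {y} fx≢fy =
      Fin.¬∀⟶∃¬ n _ (λ i → lookup x i Bool.≟ lookup y i) λ x≗y →
        fx≢fy (≡.cong f (≡.trans (≡.sym (tabulate∘lookup x))
                          (≡.trans (tabulate-cong x≗y) (tabulate∘lookup y))))

  preimages-≢ : ∀ {n} (f : BoolFun n) ((x , _) : f ⁻¹[ false ]) ((y , _) : f ⁻¹[ true ]) →
                f x ≢ f y
  preimages-≢ f (x , fx≡0) (y , fy≡1) fx≡fy =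
    case ≡.trans (≡.sym fx≡0) (≡.trans fx≡fy fy≡1) of λ ()

  -- For n = 0 there is no probability distribution on [n], hence NonZero n below.

  module _ {n : ℕ} .{{_ : NonZero n}} (f : BoolFun n) where

    PrivateStrategy : Set
    PrivateStrategy = Input n → Distribution n

    uniformStrategy : PrivateStrategy
    uniformStrategy _ = uniform n

    0≤p*q : ∀ (p : PrivateStrategy) x y i → 0# ≤ prob (p x) i * prob (p y) i
    0≤p*q p x y i = *-nonNegative (nonNegative (p x) i) (nonNegative (p y) i)

    collision : PrivateStrategy → f ⁻¹[ false ] → f ⁻¹[ true ] → Carrier
    collision p (x , _) (y , _) = sumDiffer x y λ i → prob (p x) i * prob (p y) i

    CGpriv : Carrier
    CGpriv = infimum (λ p → worstInverse f (collision p)) (λ p → 0≤worstInverse f (collision p))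
      (uniformStrategy , worstInverse-finite f (collision uniformStrategy) collision≉0)
      where
      collision≉0 : ∀ x y → collision uniformStrategy x y ≉ 0#
      collision≉0 x y = let (i , xi≢yi) = separated f (preimages-≢ f x y) in
        filteredSum-≉0 (differ? (proj₁ x) (proj₁ y)) _
          (0≤p*q uniformStrategy (proj₁ x) (proj₁ y))
          i xi≢yi (*-≉0 (uniform-≉0 n i) (uniform-≉0 n i))

    rootCollision : PrivateStrategy → f ⁻¹[ false ] → f ⁻¹[ true ] → Carrier
    rootCollision p (x , _) (y , _) =
      sumDiffer x y λ i → √ (prob (p x) i * prob (p y) i) (0≤p*q p x y i)

    MM : Carrier
    MM = infimum (λ p → worstInverse f (rootCollision p)) (λ p → 0≤worstInverse f (rootCollision p))
      (uniformStrategy , worstInverse-finite f (rootCollision uniformStrategy) rootCollision≉0)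
      where
      rootCollision≉0 : ∀ x y → rootCollision uniformStrategy x y ≉ 0#
      rootCollision≉0 x y = let (i , xi≢yi) = separated f (preimages-≢ f x y) in
        filteredSum-≉0 (differ? (proj₁ x) (proj₁ y))
          (λ j → √ _ (0≤p*q uniformStrategy (proj₁ x) (proj₁ y) j))
          (λ j → proj₁ (proj₂ (squareRoot _ (0≤p*q uniformStrategy (proj₁ x) (proj₁ y) j))))
          i xi≢yi (√-≉0 _ (*-≉0 (uniform-≉0 n i) (uniform-≉0 n i)))

    DeterministicStrategy : Set
    DeterministicStrategy = (f ⁻¹[ false ] → Fin n) × (f ⁻¹[ true ] → Fin n)

    Correct : f ⁻¹[ false ] → f ⁻¹[ true ] → Pred DeterministicStrategy 0ℓ
    Correct x y (A , B) = A x ≡ B y × Differ (proj₁ x) (proj₁ y) (A x)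

    correct? : ∀ x y AB → Dec (Correct x y AB)
    correct? x y (A , B) = (A x Fin.≟ B y) ×-dec differ? (proj₁ x) (proj₁ y) (A x)

    winProbability : Random DeterministicStrategy → f ⁻¹[ false ] → f ⁻¹[ true ] → Carrier
    winProbability p x y = probability p (correct? x y)

    CGpub : Carrier
    CGpub = infimum (λ p → worstInverse f (winProbability p))
                    (λ p → 0≤worstInverse f (winProbability p))
      (uniformIndex , worstInverse-finite f (winProbability uniformIndex) win≉0)
      where
      uniformIndex : Random DeterministicStrategy
      uniformIndex = record { law = uniform n ; outcome = λ i → (λ _ → i) , (λ _ → i) }
      win≉0 : ∀ x y → winProbability uniformIndex x y ≉ 0#
      win≉0 x y = let (i , xi≢yi) = separated f (preimages-≢ f x y) in
        filteredSum-≉0 (λ j → correct? x y (outcome uniformIndex j)) (prob (uniform n))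
          (nonNegative (uniform n)) i (≡.refl , xi≢yi) (uniform-≉0 n i)

  module _ {n : ℕ} (f : BoolFun n) where

    worstCase : (Input n → Carrier) → ℝ⁺
    worstCase v = max⁺ (List.map (λ x → [ v x ]) (inputs n))

    0≤worstCase : ∀ v → [ 0# ] ≤⁺ worstCase v
    0≤worstCase v = 0≤max⁺ (List.map (λ x → [ v x ]) (inputs n))

    worstCase-finite : ∀ v → Finite (worstCase v)
    worstCase-finite v = max⁺-finite (List.map (λ x → [ v x ]) (inputs n))
      (All.map⁺ (All.universal (λ x → v x , ≡.refl) (inputs n)))

    expectedQueries : Random (TreeFor f) → Input n → Carrier
    expectedQueries T x = expectation T λ (t , _) → fromℕ (queries t x)

    R₀ : Carrier
    R₀ = infimum (λ T → worstCase (expectedQueries T)) (λ T → 0≤worstCase (expectedQueries T))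
      (alwaysFull , worstCase-finite (expectedQueries alwaysFull))
      where
      alwaysFull : Random (TreeFor f)
      alwaysFull = record { law = uniform 1 ; outcome = λ _ → fullTree f }

    record ECWeights : Set where
      field
        w           : Input n → Fin n → Carrier
        nonNegative : ∀ z i → 0# ≤ w z i
        atMostOne   : ∀ z i → w z i ≤ 1#
        feasible    : ∀ z z′ → f z ≡ not (f z′) →
                      1# ≤ sumDiffer z z′ (λ i → w z i * w z′ i)

    totalWeight : ECWeights → Input n → Carrier
    totalWeight W z = sum (ECWeights.w W z)

    EC : Carrier
    EC = infimum (λ W → worstCase (totalWeight W)) (λ W → 0≤worstCase (totalWeight W))
      (allOnes , worstCase-finite (totalWeight allOnes))
      where
      allOnes : ECWeights
      allOnes = record
        { w           = λ _ _ → 1#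
        ; nonNegative = λ _ _ → 0≤1
        ; atMostOne   = λ _ _ → ≤-refl
        ; feasible    = λ z z′ fz≡ → let (i , zi≢z′i) = separated f (λ fz≡fz′ → Bool.not-¬ fz≡fz′ fz≡) in
            ≤-trans (≤-reflexive (sym (*-identityˡ 1#)))
              (term≤filteredSum (differ? z z′) (λ _ → 1# * 1#) (λ _ → *-nonNegative 0≤1 0≤1) i zi≢z′i)
        }

{-# OPTIONS --safe #-}
module Submission where

open import Defs
open import Data.Bool.Base using (Bool; true; false; not; if_then_else_)
import Data.Bool.Properties as Bool
open import Data.Empty using (⊥-elim)
open import Data.Fin.Base using (Fin; zero; suc; splitAt)
import Data.Fin.Properties as Fin
import Data.List.Base as List
import Data.List.Extrema.Nat as Extrema
open import Data.List.Membership.Propositional using (_∈_; lose)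
open import Data.List.Membership.Propositional.Properties
  using (∈-map⁺; ∈-map⁻; ∈-filter⁻; ∈-cartesianProductWith⁺)
import Data.List.Relation.Unary.All as All
import Data.List.Relation.Unary.All.Properties as All
import Data.List.Relation.Unary.Any as Any
import Data.List.Relation.Unary.Any.Properties as Any
open import Data.Maybe.Base using (Maybe; just; nothing; is-just)
open import Data.Maybe.Properties using (just-injective)
import Data.Maybe.Relation.Unary.Any as Maybe
open import Data.Nat.Base as ℕ using (ℕ; zero; suc; NonZero)
import Data.Nat.Properties as ℕ
open import Data.Product.Base using (∃; _×_; _,_; proj₁; proj₂)
open import Data.Sum.Base using (_⊎_; inj₁; inj₂)
import Data.Sum.Properties as Sum
open import Data.Unit.Base using (tt)
open import Data.Vec.Base as Vec using ([]; _∷_; lookup; tabulate; _[_]%=_; _[_]≔_)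
open import Data.Vec.Functional as Vector using (Vector)
open import Data.Vec.Properties
  using (lookup∘tabulate; lookup∘updateAt; lookup∘updateAt′; lookup-map; lookup-replicate)
open import Data.Vec.Relation.Binary.Pointwise.Extensional using (ext; Pointwise-≡⇒≡)
open import Function.Base using (_∘_)
open import Level using (0ℓ)
open import Relation.Binary.PropositionalEquality as ≡ using (_≡_; _≢_)
open import Relation.Binary.PropositionalEquality.WithK using (≡-irrelevant)
import Relation.Binary.Reasoning.Setoid as SetoidReasoning
open import Relation.Nullary using (¬_; Dec; yes; no; does; contradiction; ¬?; _×-dec_; _→-dec_)
open import Relation.Nullary.Construct.Add.Supremum using ([_]; ⊤⁺)
import Relation.Nullary.Decidable as Dec
open import Relation.Unary using (Pred; Decidable; Satisfiable; _⊆_)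

-- Write D(x,y) for the set of bits where x and y differ, and let f(x) ≠ f(y).
--
-- 1. For a ≥ 0 one has Σ a² ≤ (Σ a)²; take a = √(p_x p_y).
--
-- 2. Given p with Σ_{D(x,y)} p_x p_y ≥ 1/r throughout, query the unknown input
-- z as follows: choose a 0-input x and a 1-input y consistent with the answers
-- so far and query a bit drawn from (p_x + p_y)/2.  One of x, y has a value
-- other than f(z) and differs from z only at bits not yet queried, so the
-- p_z-mass of those bits drops by at least 1/(2r) in expectation.  It starts at
-- 1, so O(r) queries suffice on average.  In the other bound, weights w give
-- the strategy w_z / Σ w_z.
--
-- 3. Let q_z be the law of the answer given on z in a public coin strategy that
-- wins with probability ≥ 1/r; then q_x(D(x,y)) ≥ 1/r.  The hybrid of x and y
-- that follows y on {q_x ≤ q_y} and x elsewhere differs in value from x or from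
-- y.  In the first case it yields a minimal sensitive block B ⊆ D(x,y) of x on
-- which q_x ≤ q_y; every bit of B is sensitive for the input obtained by
-- flipping B, so |B| ≤ s(f), and
--   Σ_{D(x,y)} q_x q_y ≥ Σ_B q_x² ≥ q_x(B)²/|B| ≥ 1/(r² s(f)).
--
-- 4. Certificates of x and y conflict, so their indicators serve as weights.

-- Membership in the finite enumerations; sensitivity and certificate size

∈-preimage : ∀ {n} (f : BoolFun n) b (x : f ⁻¹[ b ]) → x ∈ preimage f b
∈-preimage f b (x , fx≡b) = Any.mapMaybe⁺ (inPreimage? f b) (inputs _)
  (Any.map⁺ (Any.map (λ { ≡.refl → ≡.subst (Maybe.Any _) (≡.sym hit) (Maybe.just ≡.refl) }) (∈-inputs x)))
  where
  hit : inPreimage? f b x ≡ just (x , fx≡b)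
  hit with f x Bool.≟ b
  -- The listed element carries the proof found by the decision procedure; irrelevance of equality
  -- proofs identifies it with the given one.
  ... | yes eq = ≡.cong (λ e → just (x , e)) (≡-irrelevant eq fx≡b)
  ... | no neq = contradiction fx≡b neq

sensitivityAt≤sensitivity : ∀ {n} (f : BoolFun n) x → sensitivityAt f x ℕ.≤ sensitivity f
sensitivityAt≤sensitivity f x =
  All.lookup (Extrema.xs≤max 0 _) (∈-map⁺ (sensitivityAt f) (∈-inputs x))

certificateAt≤certificateComplexity : ∀ {n} (f : BoolFun n) {b} {x} → f x ≡ b →
  C[ f ]at x ℕ.≤ certificateComplexity b f
certificateAt≤certificateComplexity f {b} {x} fx≡b =
  All.lookup (Extrema.xs≤max 0 _) (∈-map⁺ (C[ f ]at ∘ proj₁) (∈-preimage f b (x , fx≡b)))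

size-map-just : ∀ {n} (x : Input n) → size (Vec.map just x) ≡ n
size-map-just []      = ≡.refl
size-map-just (b ∷ x) = ≡.cong suc (size-map-just x)

map-just-isCertificate : ∀ {n} (f : BoolFun n) x → IsCertificate f x (Vec.map just x)
map-just-isCertificate f x =
  (λ i b eq → just-injective (≡.trans (≡.sym (lookup-map i just x)) eq)) ,
  (λ z con → ≡.cong f (Pointwise-≡⇒≡ (ext λ i → con i _ (lookup-map i just x))))

-- The minimum is either attained in the list or equal to its starting value `n`, and in the latter
-- case assigning every bit of `x` attains it.
smallCertificate : ∀ {n} (f : BoolFun n) x →
                   ∃ λ ρ → IsCertificate f x ρ × size ρ ℕ.≤ C[ f ]at x
smallCertificate {n} f x with
  Extrema.argmin-sel (λ k → k) n (List.map size (List.filter (isCertificate? f x) (partialAssignments n)))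
... | inj₁ C≡n = Vec.map just x , map-just-isCertificate f x ,
                 ℕ.≤-reflexive (≡.trans (size-map-just x) (≡.sym C≡n))
... | inj₂ C∈  = let (ρ , ρ∈ , C≡size) = ∈-map⁻ size C∈ in
                 ρ , proj₂ (∈-filter⁻ (isCertificate? f x) {xs = partialAssignments n} ρ∈) ,
                 ℕ.≤-reflexive (≡.sym C≡size)

-- Hybrid inputs and conflicting certificates

hybrid : ∀ {n} {P : Pred (Fin n) 0ℓ} → Input n → Input n → Decidable P → Input n
hybrid x y P? = tabulate λ i → if does (P? i) then lookup y i else lookup x i

lookup-hybrid : ∀ {n} {P : Pred (Fin n) 0ℓ} x y (P? : Decidable P) i →
                lookup (hybrid x y P?) i ≡ (if does (P? i) then lookup y i else lookup x i)
lookup-hybrid x y P? = lookup∘tabulate _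

module _ {n} (f : BoolFun n) where

  Conflict : (x y : Input n) (ρ σ : PartialAssignment n) → Pred (Fin n) 0ℓ
  Conflict x y ρ σ i = is-just (lookup ρ i) ≡ true × is-just (lookup σ i) ≡ true × Differ x y i

  -- Without a conflict, the input that follows `x` where `ρ` is assigned and `y` elsewhere would be
  -- consistent with both certificates and so have both values.
  certificates-conflict : ∀ {x y ρ σ} → f x ≢ f y → IsCertificate f x ρ → IsCertificate f y σ →
                          ∃ (Conflict x y ρ σ)
  certificates-conflict {x} {y} {ρ} {σ} fx≢fy (ρ⊆x , ρ⇒) (σ⊆y , σ⇒) =
    let (i , ¬¬c) = Fin.¬∀⟶∃¬ n (λ i → ¬ Conflict x y ρ σ i) (λ i → ¬? (conflict? i)) λ none →
                      fx≢fy (≡.trans (≡.sym (ρ⇒ merged (ρ⊆merged none))) (σ⇒ merged (σ⊆merged none)))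
    in i , Dec.decidable-stable (conflict? i) ¬¬c
    where
    conflict? : Decidable (Conflict x y ρ σ)
    conflict? i = (is-just (lookup ρ i) Bool.≟ true) ×-dec (is-just (lookup σ i) Bool.≟ true)
                  ×-dec differ? x y i
    assigned? : Decidable λ i → is-just (lookup ρ i) ≡ true
    assigned? i = is-just (lookup ρ i) Bool.≟ true
    merged : Input n
    merged = hybrid y x assigned?
    ρ⊆merged : (∀ i → ¬ Conflict x y ρ σ i) → Consistent ρ merged
    ρ⊆merged none i b ρi≡b rewrite lookup-hybrid y x assigned? i
      with assigned? i
    ... | yes _   = ρ⊆x i b ρi≡b
    ... | no  ρi≢ = contradiction (≡.cong is-just ρi≡b) ρi≢
    σ⊆merged : (∀ i → ¬ Conflict x y ρ σ i) → Consistent σ merged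
    σ⊆merged none i b σi≡b rewrite lookup-hybrid y x assigned? i
      with assigned? i
    ... | no  _  = σ⊆y i b σi≡b
    -- Both certificates assign bit `i` here, so the absence of a conflict makes `x` and `y` agree
    -- on it.
    ... | yes ρi = ≡.trans
      (Dec.decidable-stable (lookup x i Bool.≟ lookup y i) λ xi≢yi →
        none i (ρi , ≡.cong is-just σi≡b , xi≢yi))
      (σ⊆y i b σi≡b)

-- Minimal sensitive blocks

-- The measure that decreases while a block is being shrunk.
hamming : ∀ {n} → Input n → Input n → ℕ
hamming []      []      = 0
hamming (a ∷ x) (b ∷ y) = (if does (a Bool.≟ b) then 0 else 1) ℕ.+ hamming x y

hamming-flip : ∀ {n} (x z : Input n) i → Differ x z i →
               hamming x z ≡ suc (hamming x (z [ i ]%= not))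
hamming-flip (a ∷ x) (b ∷ z) zero    a≢b with a | b
... | false | false = contradiction ≡.refl a≢b
... | false | true  = ≡.refl
... | true  | false = ≡.refl
... | true  | true  = contradiction ≡.refl a≢b
hamming-flip (a ∷ x) (b ∷ z) (suc i) xi≢zi = ≡.trans
  (≡.cong ((if does (a Bool.≟ b) then 0 else 1) ℕ.+_) (hamming-flip x z i xi≢zi))
  (ℕ.+-suc (if does (a Bool.≟ b) then 0 else 1) _)

differ-flip : ∀ {n} (x z : Input n) i → Differ x z i →
              ∀ j → Differ x (z [ i ]%= not) j → Differ x z j
differ-flip x z i xi≢zi j xj≢zj′ with j Fin.≟ i
... | yes ≡.refl = xi≢zi
... | no  j≢i    = λ xj≡zj → xj≢zj′ (≡.trans xj≡zj (≡.sym (lookup∘updateAt′ j i j≢i z)))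

module _ {n} (f : BoolFun n) where

  -- D(x,z) is a sensitive block of x, minimal in that z has value f(x) once
  -- any one of its bits is restored.
  MinimalBlock : Input n → Input n → Set
  MinimalBlock x z = f z ≢ f x × (∀ i → Differ x z i → f (z [ i ]%= not) ≡ not (f z))

  -- As long as some differing bit can be restored without changing the value of `y`, it is
  -- restored. Each time the distance to `x` drops by one and the set of differing bits only
  -- shrinks.
  minimalBlock : ∀ x y → f y ≢ f x →
                 ∃ λ z → MinimalBlock x z × (∀ i → Differ x z i → Differ x y i)
  minimalBlock x y = shrink (hamming x y) y ≡.refl
    where
    shrink : ∀ k y → hamming x y ≡ k → f y ≢ f x →
             ∃ λ z → MinimalBlock x z × (∀ i → Differ x z i → Differ x y i)
    shrink k y eq fy≢fx with
      Fin.all? (λ i → differ? x y i →-dec f (y [ i ]%= not) Bool.≟ not (f y))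
    ... | yes min = y , (fy≢fx , min) , λ i d → d
    ... | no ¬min with
      Fin.¬∀⟶∃¬ n _ (λ i → differ? x y i →-dec f (y [ i ]%= not) Bool.≟ not (f y)) ¬min
    ...   | i , ¬sens with differ? x y i
    ...     | no  same = contradiction (λ d → contradiction d same) ¬sens
    ...     | yes xi≢yi = next k (≡.trans (≡.sym eq) (hamming-flip x y i xi≢yi))
      where
      fy′≡fy : f (y [ i ]%= not) ≡ f y
      -- A Boolean other than `not (f y)` is `f y`.
      fy′≡fy = ≡.trans (Bool.¬-not (¬sens ∘ λ e _ → e)) (Bool.not-involutive (f y))
      -- Matching on the old distance exposes its predecessor, on which the recursion is structural.
      next : ∀ k → k ≡ suc (hamming x (y [ i ]%= not)) →
             ∃ λ z → MinimalBlock x z × (∀ i → Differ x z i → Differ x y i)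
      next zero    ()
      next (suc k) eq =
        let (z , min , sub) = shrink k (y [ i ]%= not) (≡.sym (ℕ.suc-injective eq))
                                (fy≢fx ∘ ≡.trans (≡.sym fy′≡fy))
        in z , min , λ j → differ-flip x y i xi≢yi j ∘ sub j

  -- The hybrid departs from `x` only on `P` and from `y` only off `P`, and a minimal block taken
  -- inside either difference inherits this.
  splitBlock : ∀ {P : Pred (Fin n) 0ℓ} → Decidable P → ∀ x y → f x ≢ f y →
    (∃ λ z → MinimalBlock x z × (∀ i → Differ x z i → Differ x y i × P i)) ⊎
    (∃ λ z → MinimalBlock y z × (∀ i → Differ y z i → Differ y x i × ¬ P i))
  splitBlock {P} P? x y fx≢fy with f (hybrid x y P?) Bool.≟ f x
  ... | no  fh≢fx =
    let (z , min , sub) = minimalBlock x _ fh≢fx in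
    inj₁ (z , min , λ i → ≢x i ∘ sub i)
    where
    ≢x : ∀ i → Differ x (hybrid x y P?) i → Differ x y i × P i
    ≢x i d rewrite lookup-hybrid x y P? i with P? i
    ... | yes Pi = d , Pi
    ... | no  _  = contradiction ≡.refl d
  ... | yes fh≡fx =
    let (z , min , sub) = minimalBlock y _ (fx≢fy ∘ ≡.trans (≡.sym fh≡fx)) in
    inj₂ (z , min , λ i → ≢y i ∘ sub i)
    where
    ≢y : ∀ i → Differ y (hybrid x y P?) i → Differ y x i × ¬ P i
    ≢y i d rewrite lookup-hybrid x y P? i with P? i
    ... | yes _  = contradiction ≡.refl d
    ... | no ¬Pi = d , ¬Pi

-- Tree depth and inputs consistent with a partial assignment

depth : ∀ {n} → DecisionTree n → ℕ
depth (leaf _)     = 0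
depth (node _ l r) = suc (depth l ℕ.⊔ depth r)

queries≤depth : ∀ {n} (t : DecisionTree n) x → queries t x ℕ.≤ depth t
queries≤depth (leaf _)     x = ℕ.z≤n
queries≤depth (node i l r) x with lookup x i
... | false = ℕ.s≤s (ℕ.m≤n⇒m≤n⊔o (depth r) (queries≤depth l x))
... | true  = ℕ.s≤s (ℕ.m≤n⇒m≤o⊔n (depth l) (queries≤depth r x))

consistent-update : ∀ {n} (ρ : PartialAssignment n) (x : Input n) i → Consistent ρ x →
                    Consistent (ρ [ i ]≔ just (lookup x i)) x
consistent-update ρ x i con j b eq with j Fin.≟ i
... | yes ≡.refl = just-injective (≡.trans (≡.sym (lookup∘updateAt i ρ)) eq)
... | no  j≢i    = con j b (≡.trans (≡.sym (lookup∘updateAt′ j i j≢i ρ)) eq)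

findInput? : ∀ {n} {P : Pred (Input n) 0ℓ} → Decidable P → Dec (∃ P)
findInput? {n} P? = Dec.map′ Any.satisfied (λ (x , Px) → lose (∈-inputs x) Px) (Any.any? P? (inputs n))

module Bounds (ℛ : CompleteOrderedField) where

  open CompleteOrderedField ℛ hiding (zero)
  open RealProperties ℛ
  open Measures ℛ
  open Distribution
  open Random
  open import Algebra.Properties.Ring ring using (-‿distribʳ-*; -‿distribˡ-*; -‿involutive)
  open import Algebra.Properties.Semiring.Sum semiring
    using (∑-comm; ∑-distrib-+; *-distribˡ-sum; *-distribʳ-sum; sum-replicate-zero)
    renaming (sum-cong-≋ to sum-cong)
  open import Algebra.Solver.Ring.NaturalCoefficients.Default commutativeSemiring
    using (solve; _:=_; _:+_; _:*_)
  open SetoidReasoning setoid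

  private variable
    m n : ℕ

  -- Ordered-field inequalities and finite sums

  0≤fromℕ : ∀ k → 0# ≤ fromℕ k
  0≤fromℕ zero    = ≤-refl
  0≤fromℕ (suc k) = 0≤+ 0≤1 (0≤fromℕ k)

  fromℕ-mono-≤ : m ℕ.≤ n → fromℕ m ≤ fromℕ n
  fromℕ-mono-≤ {n = n} ℕ.z≤n = 0≤fromℕ n
  fromℕ-mono-≤ (ℕ.s≤s m≤n)   = +-monoʳ-≤ 1# (fromℕ-mono-≤ m≤n)

  *-mono-≤ : ∀ {a b c d} → 0# ≤ b → 0# ≤ c → a ≤ b → c ≤ d → a * c ≤ b * d
  *-mono-≤ 0≤b 0≤c a≤b c≤d = ≤-trans (*-monoˡ-≤ 0≤c a≤b) (*-monoʳ-≤ 0≤b c≤d)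

  square-nonNegative : ∀ a → 0# ≤ a * a
  square-nonNegative a with ≤-total 0# a
  ... | inj₁ 0≤a = *-nonNegative 0≤a 0≤a
  ... | inj₂ a≤0 = ≤-resp refl [-a][-a] (*-nonNegative 0≤-a 0≤-a)
    where
    0≤-a : 0# ≤ - a
    0≤-a = ≤-resp refl (+-identityˡ (- a)) (x≤y⇒0≤y-x a≤0)
    [-a][-a] : - a * - a ≈ a * a
    [-a][-a] = begin
      - a * - a      ≈⟨ -‿distribˡ-* a (- a) ⟨
      - (a * - a)    ≈⟨ -‿cong (-‿distribʳ-* a a) ⟨
      - - (a * a)    ≈⟨ -‿involutive (a * a) ⟩
      a * a          ∎

  2ab≤a²+b² : ∀ a b → a * b + a * b ≤ a * a + b * b
  2ab≤a²+b² a b = ≤-resp (+-identityʳ _) eq (+-monoʳ-≤ (a * b + a * b) (square-nonNegative (b - a)))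
    where
    -- Writing `b` as `a + d` turns the claim into a semiring identity plus the square of `d`.
    d = b - a
    eq : (a * b + a * b) + d * d ≈ a * a + b * b
    eq = begin
      (a * b + a * b) + d * d                   ≈⟨ +-congʳ (+-cong (*-congˡ b≈) (*-congˡ b≈)) ⟨
      (a * (a + d) + a * (a + d)) + d * d
        ≈⟨ solve 2 (λ a d → (a :* (a :+ d) :+ a :* (a :+ d)) :+ d :* d
                         := a :* a :+ (a :+ d) :* (a :+ d)) refl a d ⟩
      a * a + (a + d) * (a + d)                 ≈⟨ +-congˡ (*-cong b≈ b≈) ⟩
      a * a + b * b                             ∎
      where
      b≈ : a + d ≈ b
      b≈ = x+[y-x] a b

  *-cancelˡ-≤ : ∀ {c a b} → 0# ≤ c → c ≉ 0# → c * a ≤ c * b → a ≤ b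
  *-cancelˡ-≤ {c} 0≤c c≉0 ca≤cb =
    ≤-resp (cancel _) (cancel _) (*-monoʳ-≤ (inverse-nonNegative 0≤c cc′≈1) ca≤cb)
    where
    c′ = proj₁ (inverse c c≉0)
    cc′≈1 = proj₂ (inverse c c≉0)
    cancel : ∀ a → c′ * (c * a) ≈ a
    cancel a = begin
      c′ * (c * a)  ≈⟨ *-assoc c′ c a ⟨
      (c′ * c) * a  ≈⟨ *-congʳ (trans (*-comm c′ c) cc′≈1) ⟩
      1# * a        ≈⟨ *-identityˡ a ⟩
      a             ∎

  sum-mono-≤ : {u v : Vector Carrier n} → (∀ i → u i ≤ v i) → sum u ≤ sum v
  sum-mono-≤ {n = zero}  u≤v = ≤-refl
  sum-mono-≤ {n = suc n} u≤v = +-mono-≤ (u≤v zero) (sum-mono-≤ (u≤v ∘ suc))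

  -- Here `v` is `u` with entry `i` erased, described by its values so that it applies to the fresh
  -- mass before and after a query.
  sum-extract : {u v : Vector Carrier n} (i : Fin n) → (∀ k → k ≢ i → u k ≈ v k) → v i ≈ 0# →
                sum u ≈ u i + sum v
  sum-extract {u = u} {v} zero    u≈v v₀≈0 = +-congˡ (begin
    sum (u ∘ suc)          ≈⟨ sum-cong (λ k → u≈v (suc k) λ ()) ⟩
    sum (v ∘ suc)          ≈⟨ +-identityˡ _ ⟨
    0# + sum (v ∘ suc)     ≈⟨ +-congʳ v₀≈0 ⟨
    v zero + sum (v ∘ suc) ∎)
  sum-extract {u = u} {v} (suc i) u≈v vᵢ≈0 = begin
    u zero + sum (u ∘ suc)
      ≈⟨ +-cong (u≈v zero λ ()) (sum-extract i (λ k k≢i → u≈v (suc k) (k≢i ∘ Fin.suc-injective)) vᵢ≈0) ⟩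
    v zero + (u (suc i) + sum (v ∘ suc))
      ≈⟨ solve 3 (λ a b c → a :+ (b :+ c) := b :+ (a :+ c)) refl (v zero) (u (suc i)) _ ⟩
    u (suc i) + (v zero + sum (v ∘ suc)) ∎

  sum-single : {u : Vector Carrier n} (i : Fin n) → (∀ k → k ≢ i → u k ≈ 0#) → sum u ≈ u i
  sum-single {n = n} {u} i u≈0 = begin
    sum u                      ≈⟨ sum-extract {v = λ _ → 0#} i u≈0 refl ⟩
    u i + sum {n} (λ _ → 0#)   ≈⟨ +-congˡ (sum-replicate-zero n) ⟩
    u i + 0#                   ≈⟨ +-identityʳ (u i) ⟩
    u i                        ∎

  if-sum : ∀ b (v : Vector Carrier n) →
           (if b then sum v else 0#) ≈ sum (λ i → if b then v i else 0#)
  if-sum         true  v = refl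
  if-sum {n = n} false v = sym (sum-replicate-zero n)

  module _ {P : Pred (Fin n) 0ℓ} (P? : ∀ i → Dec (P i)) where

    filteredSum-cong : {u v : Vector Carrier n} → (∀ i → u i ≈ v i) →
                       filteredSum P? u ≈ filteredSum P? v
    filteredSum-cong {u} {v} u≈v = sum-cong λ i → help i (does (P? i))
      where
      help : ∀ i b → (if b then u i else 0#) ≈ (if b then v i else 0#)
      help i true  = u≈v i
      help i false = refl

    filteredSum-nonNegative : {v : Vector Carrier n} → (∀ i → 0# ≤ v i) → 0# ≤ filteredSum P? v
    filteredSum-nonNegative {v} 0≤v = sum-nonNegative λ i → help i (does (P? i))
      where
      help : ∀ i b → 0# ≤ (if b then v i else 0#)
      help i true  = 0≤v i
      help i false = ≤-refl

    filteredSum-mono-≤ : {Q : Pred (Fin n) 0ℓ} (Q? : ∀ i → Dec (Q i)) {u v : Vector Carrier n} →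
                         (∀ i → 0# ≤ v i) → (∀ i → P i → Q i × u i ≤ v i) →
                         filteredSum P? u ≤ filteredSum Q? v
    filteredSum-mono-≤ {Q} Q? {u} {v} 0≤v P⇒ = sum-mono-≤ λ i → help i (P? i) (Q? i)
      where
      help : ∀ i (p : Dec (P i)) (q : Dec (Q i)) →
             (if does p then u i else 0#) ≤ (if does q then v i else 0#)
      help i (yes p) (yes q) = proj₂ (P⇒ i p)
      help i (yes p) (no ¬q) = contradiction (proj₁ (P⇒ i p)) ¬q
      help i (no ¬p) (yes q) = 0≤v i
      help i (no ¬p) (no ¬q) = ≤-refl

    *-distribˡ-filteredSum : ∀ a (v : Vector Carrier n) →
                             a * filteredSum P? v ≈ filteredSum P? (λ i → a * v i)
    *-distribˡ-filteredSum a v = trans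
      (*-distribˡ-sum a λ i → if does (P? i) then v i else 0#)
      (sum-cong λ i → help i (does (P? i)))
      where
      help : ∀ i b → a * (if b then v i else 0#) ≈ (if b then a * v i else 0#)
      help i true  = refl
      help i false = zeroʳ a

    filteredSum-distrib-+ : (u v : Vector Carrier n) →
      filteredSum P? (λ i → u i + v i) ≈ filteredSum P? u + filteredSum P? v
    filteredSum-distrib-+ u v =
      trans (sum-cong λ i → help i (does (P? i)))
            (∑-distrib-+ (λ i → if does (P? i) then u i else 0#) (λ i → if does (P? i) then v i else 0#))
      where
      help : ∀ i b → (if b then u i + v i else 0#) ≈ (if b then u i else 0#) + (if b then v i else 0#)
      help i true  = refl
      help i false = sym (+-identityʳ 0#)

  -- The general `g`, in place of the identity, lets the induction pass to `g ∘ suc`.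
  length-filter-tabulate : ∀ {P : Pred (Fin m) 0ℓ} (P? : ∀ i → Dec (P i)) (g : Fin n → Fin m) →
    fromℕ (List.length (List.filter P? (List.tabulate g))) ≈ filteredSum (P? ∘ g) (λ _ → 1#)
  length-filter-tabulate {n = zero}  P? g = refl
  length-filter-tabulate {n = suc n} P? g with does (P? (g zero))
  ... | true  = +-congˡ (length-filter-tabulate P? (g ∘ suc))
  ... | false = trans (length-filter-tabulate P? (g ∘ suc)) (sym (+-identityˡ _))

  -- Expanding the square of head plus tail leaves cross terms, which are nonnegative.
  square-sum : {v : Vector Carrier n} → (∀ i → 0# ≤ v i) →
               sum (λ i → v i * v i) ≤ sum v * sum v
  square-sum {n = zero}  0≤v = ≤-reflexive (sym (zeroˡ 0#))
  square-sum {n = suc n} {v} 0≤v =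
    ≤-trans (+-monoʳ-≤ (a * a) (square-sum (0≤v ∘ suc)))
      (≤-resp refl
        (solve 2 (λ a s → (a :* a :+ s :* s) :+ (a :* s :+ a :* s) := (a :+ s) :* (a :+ s)) refl a s)
        (x≤x+y (0≤+ 0≤as 0≤as)))
    where
    a = v zero
    s = sum (v ∘ suc)
    0≤as : 0# ≤ a * s
    0≤as = *-nonNegative (0≤v zero) (sum-nonNegative (0≤v ∘ suc))

  filtered-square-sum : ∀ {P : Pred (Fin n) 0ℓ} (P? : ∀ i → Dec (P i)) {v : Vector Carrier n} →
    (∀ i → 0# ≤ v i) → filteredSum P? (λ i → v i * v i) ≤ filteredSum P? v * filteredSum P? v
  filtered-square-sum P? {v} 0≤v =
    ≤-trans (≤-reflexive (sum-cong λ i → square i (does (P? i))))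
            (square-sum λ i → 0≤term i (does (P? i)))
    where
    square : ∀ i b → (if b then v i * v i else 0#) ≈ (if b then v i else 0#) * (if b then v i else 0#)
    square i true  = refl
    square i false = sym (zeroˡ 0#)
    0≤term : ∀ i b → 0# ≤ (if b then v i else 0#)
    0≤term i true  = 0≤v i
    0≤term i false = ≤-refl

  -- Cauchy–Schwarz for a sum of at most s terms; it comes from 2sv ≤ s²v² + 1.
  cauchySchwarz : ∀ {P : Pred (Fin n) 0ℓ} (P? : ∀ i → Dec (P i)) {v : Vector Carrier n} {s} →
    filteredSum P? (λ _ → 1#) ≤ s → 1# ≤ s → 1# ≤ filteredSum P? v →
    1# ≤ s * filteredSum P? (λ i → v i * v i)
  cauchySchwarz P? {v} {s} N≤s 1≤s 1≤S = *-cancelˡ-≤ 0≤s (1≤⇒≉0 1≤s)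
    -- Summation gives 2s ≤ 2sS ≤ s²Q + s, with at most `s` ones on the right; a summand `s` and
    -- then a factor `s` are cancelled.
    (≤-resp (sym (*-identityʳ s)) refl (+-cancelˡ-≤ s
      (≤-trans (+-mono-≤ s≤sS s≤sS)
        (≤-resp 2sS rhs (≤-trans step (+-monoʳ-≤ (s * (s * Q)) N≤s))))))
    where
    S = filteredSum P? v
    Q = filteredSum P? (λ i → v i * v i)
    0≤s : 0# ≤ s
    0≤s = ≤-trans 0≤1 1≤s
    s≤sS : s ≤ s * S
    s≤sS = ≤-resp (*-identityʳ s) refl (*-monoʳ-≤ 0≤s 1≤S)
    pointwise : ∀ i → s * v i + s * v i ≤ (s * (s * (v i * v i)) + 1#)
    pointwise i = ≤-resp
      (+-cong (*-identityʳ _) (*-identityʳ _))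
      (+-cong (solve 2 (λ s a → (s :* a) :* (s :* a) := s :* (s :* (a :* a))) refl s (v i))
              (*-identityʳ 1#))
      (2ab≤a²+b² (s * v i) 1#)
    step : filteredSum P? (λ i → s * v i + s * v i) ≤ s * (s * Q) + filteredSum P? (λ _ → 1#)
    step = ≤-trans
      (filteredSum-mono-≤ P? P?
        (λ i → 0≤+ (*-nonNegative 0≤s (*-nonNegative 0≤s (square-nonNegative (v i)))) 0≤1)
        (λ i p → p , pointwise i))
      (≤-reflexive (trans (filteredSum-distrib-+ P? _ _) (+-congʳ (sym
        (trans (*-congˡ (*-distribˡ-filteredSum P? s _)) (*-distribˡ-filteredSum P? s _))))))
    2sS : filteredSum P? (λ i → s * v i + s * v i) ≈ s * S + s * S
    2sS = trans (filteredSum-distrib-+ P? _ _)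
      (+-cong (sym (*-distribˡ-filteredSum P? s v)) (sym (*-distribˡ-filteredSum P? s v)))
    rhs : s * (s * Q) + s ≈ s + s * (s * Q)
    rhs = +-comm _ s

  -- Square roots, infima and worst cases in [0,+∞]

  √-nonNegative : ∀ {x} (0≤x : 0# ≤ x) → 0# ≤ √ x 0≤x
  √-nonNegative {x} 0≤x = proj₁ (proj₂ (squareRoot x 0≤x))

  √-square : ∀ {x} (0≤x : 0# ≤ x) → √ x 0≤x * √ x 0≤x ≈ x
  √-square {x} 0≤x = proj₂ (proj₂ (squareRoot x 0≤x))

  -- After squaring this is 1 ≤ rd ≤ rc². It converts a bound `r` for the collision sum into a bound
  -- √r for the sum of roots.
  1≤√* : ∀ {r c d} (0≤r : 0# ≤ r) → 0# ≤ c → 1# ≤ r * d → d ≤ c * c → 1# ≤ √ r 0≤r * c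
  1≤√* {r} {c} {d} 0≤r 0≤c 1≤rd d≤cc =
    square-cancel-≤ 0≤1 (*-nonNegative (√-nonNegative 0≤r) 0≤c)
      (≤-resp (sym (*-identityˡ 1#)) eq (≤-trans 1≤rd (*-monoʳ-≤ 0≤r d≤cc)))
    where
    eq : r * (c * c) ≈ (√ r 0≤r * c) * (√ r 0≤r * c)
    eq = trans (*-congʳ (sym (√-square 0≤r)))
      (solve 2 (λ t c → (t :* t) :* (c :* c) := (t :* c) :* (t :* c)) refl (√ r 0≤r) c)

  -- The witnesses of satisfiability and boundedness are generalised, since
  -- those occurring in the complexity measures cannot be named.
  module _ {I : Set} (v : I → ℝ⁺)
           {sat : Satisfiable λ l → ∀ i → [ l ] ≤⁺ v i}
           {bdd : ∃ λ b → (λ l → ∀ i → [ l ] ≤⁺ v i) ⊆ (_≤ b)} where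

    private
      inf : Carrier
      inf = proj₁ (supremum (λ l → ∀ i → [ l ] ≤⁺ v i) sat bdd)

    infimum-≤ : ∀ {r} i → v i ≤⁺ [ r ] → inf ≤ r
    infimum-≤ i vi≤r = proj₂ (proj₂ (supremum (λ l → ∀ i → [ l ] ≤⁺ v i) sat bdd)) _
      λ l≤v → [≤]-injective (≤⁺-trans ≤-trans (l≤v i) vi≤r)

    -- Every real lies below `⊤⁺`, so only the finite members have to be compared with `l`.
    infimum-greatest : ∀ {l} → (∀ i r → v i ≡ [ r ] → l ≤ r) → l ≤ inf
    infimum-greatest {l} l≤ =
      proj₁ (proj₂ (supremum (λ l → ∀ i → [ l ] ≤⁺ v i) sat bdd)) λ i → below i (v i) ≡.refl
      where
      below : ∀ i w → v i ≡ w → [ l ] ≤⁺ w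
      below i [ r ] eq = [ l≤ i r eq ]
      below i ⊤⁺    _  = _ ≤⊤⁺

    -- The quotient of `a` by `K` is a lower bound of all finite members.
    infimum-scale : ∀ {a K} → 0# ≤ K → K ≉ 0# → (∀ i r → v i ≡ [ r ] → a ≤ K * r) → a ≤ K * inf
    infimum-scale {a} {K} 0≤K K≉0 a≤ = ≤-resp KK′a≈a refl (*-monoʳ-≤ 0≤K (infimum-greatest λ i r eq →
      *-cancelˡ-≤ 0≤K K≉0 (≤-resp (sym KK′a≈a) refl (a≤ i r eq))))
      where
      K′ = proj₁ (inverse K K≉0)
      KK′a≈a : K * (K′ * a) ≈ a
      KK′a≈a = trans (sym (*-assoc K K′ a))
        (trans (*-congʳ (proj₂ (inverse K K≉0))) (*-identityˡ a))

    -- The square root of `a` divided by `K` lies below every finite member, hence below the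
    -- infimum, and squaring gives the claim. `K` may vanish: in one application it is the
    -- sensitivity, which is zero for constant functions.
    infimum-square : (∀ {i r} → v i ≡ [ r ] → 0# ≤ r) →
                     ∀ {a K} → 0# ≤ a → 0# ≤ K → (∀ i r → v i ≡ [ r ] → a ≤ K * (r * r)) →
                     a ≤ K * (inf * inf)
    infimum-square 0≤v {a} {K} 0≤a 0≤K a≤ with K ≟ 0#
    ... | yes K≈0 = ≤-resp refl (sym (trans (*-congʳ K≈0) (zeroˡ _))) a≤0
      where
      a≤0 : a ≤ 0#
      a≤0 with a ≤? 0#
      ... | yes a≤0 = a≤0
      -- Otherwise no member would be finite, so every real would be a lower bound, even `inf + 1#`.
      ... | no  a≰0 = ⊥-elim (0≉1 (≤-antisym 0≤1 (+-cancelˡ-≤ inf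
              (≤-resp refl (sym (+-identityʳ inf)) (infimum-greatest λ i r eq →
                contradiction (≤-trans (a≤ i r eq) (≤-reflexive (trans (*-congʳ K≈0) (zeroˡ _)))) a≰0)))))
    ... | no K≉0 = ≤-resp Kt²≈a refl (*-monoʳ-≤ 0≤K (*-mono-≤ 0≤inf 0≤t t≤inf t≤inf))
      where
      0≤inf : 0# ≤ inf
      0≤inf = infimum-greatest λ i r eq → 0≤v eq
      K′ = proj₁ (inverse K K≉0)
      KK′≈1 = proj₂ (inverse K K≉0)
      0≤K′ = inverse-nonNegative 0≤K KK′≈1
      root = squareRoot (K′ * a) (*-nonNegative 0≤K′ 0≤a)
      t = proj₁ root
      0≤t = proj₁ (proj₂ root)
      Kt²≈a : K * (t * t) ≈ a
      Kt²≈a = begin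
        K * (t * t)    ≈⟨ *-congˡ (proj₂ (proj₂ root)) ⟩
        K * (K′ * a)   ≈⟨ *-assoc K K′ a ⟨
        (K * K′) * a   ≈⟨ *-congʳ KK′≈1 ⟩
        1# * a         ≈⟨ *-identityˡ a ⟩
        a              ∎
      t≤inf : t ≤ inf
      t≤inf = infimum-greatest λ i r eq →
        square-cancel-≤ 0≤t (0≤v eq)
          (*-cancelˡ-≤ 0≤K K≉0 (≤-resp (sym Kt²≈a) refl (a≤ i r eq)))

  ≤-recip⁺ : ∀ {r s} → 0# ≤ s → recip⁺ s ≤⁺ [ r ] → 1# ≤ r * s
  ≤-recip⁺ {r} {s} 0≤s s⁻¹≤r with s ≟ 0#
  -- The case `s ≈ 0#` is absent since `⊤⁺` does not lie below a real.
  ≤-recip⁺ {r} {s} 0≤s [ s′≤r ] | no s≉0 =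
    ≤-resp (trans (*-comm _ s) (proj₂ (inverse s s≉0))) refl (*-monoˡ-≤ 0≤s s′≤r)

  recip⁺-≤ : ∀ {r s} → 0# ≤ s → 1# ≤ r * s → recip⁺ s ≤⁺ [ r ]
  recip⁺-≤ {r} {s} 0≤s 1≤rs with s ≟ 0#
  ... | yes s≈0 = contradiction (trans (*-congˡ s≈0) (zeroʳ r)) (1≤⇒≉0 1≤rs)
  ... | no  s≉0 = [ ≤-resp (*-identityˡ s′) rss′≈r (*-monoˡ-≤ (inverse-nonNegative 0≤s ss′≈1) 1≤rs) ]
    where
    s′ = proj₁ (inverse s s≉0)
    ss′≈1 = proj₂ (inverse s s≉0)
    rss′≈r : (r * s) * s′ ≈ r
    rss′≈r = trans (*-assoc r s s′) (trans (*-congˡ ss′≈1) (*-identityʳ r))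

  module _ (f : BoolFun n) (s : f ⁻¹[ false ] → f ⁻¹[ true ] → Carrier) (0≤s : ∀ x y → 0# ≤ s x y) where

    -- Bounds on reciprocals are handled in the division-free form `1# ≤ r * s x y`. The hypothesis
    -- `0# ≤ r` covers the starting value of the maximum, which is its value for constant `f`.
    worstInverse-≤ : ∀ {r} → 0# ≤ r → (∀ x y → 1# ≤ r * s x y) → worstInverse f s ≤⁺ [ r ]
    worstInverse-≤ 0≤r 1≤rs = Extrema⁺.max≤v⁺ [ 0≤r ]
      (All.cartesianProductWith⁺ (≡.setoid _) (≡.setoid _) (λ x y → recip⁺ (s x y))
        (preimage f false) (preimage f true)
        (λ {x} {y} _ _ → recip⁺-≤ (0≤s x y) (1≤rs x y)))

    ≤-worstInverse : ∀ {r} → worstInverse f s ≡ [ r ] → ∀ x y → 1# ≤ r * s x y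
    ≤-worstInverse worst≡r x y = ≤-recip⁺ (0≤s x y) (≡.subst (recip⁺ (s x y) ≤⁺_) worst≡r
      (All.lookup (Extrema⁺.xs≤max [ 0# ] (inverses f s))
        (∈-cartesianProductWith⁺ (λ x y → recip⁺ (s x y))
          (∈-preimage f false x) (∈-preimage f true y))))

    worstInverse≡⇒nonNegative : ∀ {r} → worstInverse f s ≡ [ r ] → 0# ≤ r
    worstInverse≡⇒nonNegative eq = [≤]-injective (≡.subst ([ 0# ] ≤⁺_) eq (0≤worstInverse f s))

  module _ (f : BoolFun n) (v : Input n → Carrier) where

    worstCase-≤ : ∀ {r} → 0# ≤ r → (∀ x → v x ≤ r) → worstCase f v ≤⁺ [ r ]
    worstCase-≤ 0≤r v≤r = Extrema⁺.max≤v⁺ [ 0≤r ]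
      (All.map⁺ (All.universal (λ x → [ v≤r x ]) (inputs n)))

    ≤-worstCase : ∀ {r} → worstCase f v ≡ [ r ] → ∀ x → v x ≤ r
    ≤-worstCase eq x = [≤]-injective (≡.subst ([ v x ] ≤⁺_) eq
      (All.lookup (Extrema⁺.xs≤max [ 0# ] (List.map (λ x → [ v x ]) (inputs n)))
        (∈-map⁺ (λ x → [ v x ]) (∈-inputs x))))

    worstCase≡⇒nonNegative : ∀ {r} → worstCase f v ≡ [ r ] → 0# ≤ r
    worstCase≡⇒nonNegative eq = [≤]-injective (≡.subst ([ 0# ] ≤⁺_) eq (0≤worstCase f v))

  -- Private coin strategies: MM, EC and certificates

  -- The product form of the equation also makes sense for weights that all vanish, where the
  -- uniform distribution is chosen.
  normalise : .{{_ : NonZero n}} (w : Fin n → Carrier) → (∀ i → 0# ≤ w i) →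
              ∃ λ (d : Distribution n) → ∀ i → w i ≈ sum w * prob d i
  normalise {n} w 0≤w with sum w ≟ 0#
  ... | yes S≈0 = uniform n , λ i → trans
          (≤-antisym (≤-trans (term≤sum 0≤w i) (≤-reflexive S≈0)) (0≤w i))
          (sym (trans (*-congʳ S≈0) (zeroˡ _)))
  ... | no  S≉0 = record
          { prob        = λ i → S′ * w i
          ; nonNegative = λ i → *-nonNegative (inverse-nonNegative (sum-nonNegative 0≤w) SS′≈1) (0≤w i)
          ; total       = trans (sym (*-distribˡ-sum S′ w)) (trans (*-comm S′ _) SS′≈1)
          } , λ i → sym (trans (sym (*-assoc _ S′ (w i))) (trans (*-congʳ SS′≈1) (*-identityˡ (w i))))
    where
    S′ = proj₁ (inverse (sum w) S≉0)
    SS′≈1 = proj₂ (inverse (sum w) S≉0)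

  module _ .{{_ : NonZero n}} (f : BoolFun n) where

    collision-nonNegative : ∀ p x y → 0# ≤ collision f p x y
    collision-nonNegative p (x , _) (y , _) = filteredSum-nonNegative (differ? x y) (0≤p*q f p x y)

    collision-swap : ∀ (p : PrivateStrategy f) x y →
      sumDiffer x y (λ i → prob (p x) i * prob (p y) i) ≤ sumDiffer y x (λ i → prob (p y) i * prob (p x) i)
    collision-swap p x y = filteredSum-mono-≤ (differ? x y) (differ? y x) (0≤p*q f p y x)
      λ i xi≢yi → xi≢yi ∘ ≡.sym , ≤-reflexive (*-comm (prob (p x) i) (prob (p y) i))

    rootCollision-nonNegative : ∀ p x y → 0# ≤ rootCollision f p x y
    rootCollision-nonNegative p (x , _) (y , _) = filteredSum-nonNegative (differ? x y) λ i →
      √-nonNegative (0≤p*q f p x y i)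

    winProbability-nonNegative : ∀ p x y → 0# ≤ winProbability f p x y
    winProbability-nonNegative p x y =
      filteredSum-nonNegative (λ k → correct? f x y (outcome p k)) (nonNegative (law p))

    CGpriv-≤ : ∀ {r} p → 0# ≤ r → (∀ x y → 1# ≤ r * collision f p x y) → CGpriv f ≤ r
    CGpriv-≤ p 0≤r 1≤rc = infimum-≤ (λ p → worstInverse f (collision f p)) p
      (worstInverse-≤ f (collision f p) (collision-nonNegative p) 0≤r 1≤rc)

    CGpriv-nonNegative : 0# ≤ CGpriv f
    CGpriv-nonNegative = infimum-greatest (λ p → worstInverse f (collision f p)) λ p _ →
      worstInverse≡⇒nonNegative f (collision f p) (collision-nonNegative p)

    MM-nonNegative : 0# ≤ MM f
    MM-nonNegative = infimum-greatest (λ p → worstInverse f (rootCollision f p)) λ p _ →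
      worstInverse≡⇒nonNegative f (rootCollision f p) (rootCollision-nonNegative p)

    collision≤rootCollision² : ∀ p x y →
      collision f p x y ≤ rootCollision f p x y * rootCollision f p x y
    collision≤rootCollision² p (x , _) (y , _) = ≤-trans
      (≤-reflexive (filteredSum-cong (differ? x y) λ i → sym (√-square (0≤p*q f p x y i))))
      (filtered-square-sum (differ? x y) λ i → √-nonNegative (0≤p*q f p x y i))

    MM²≤CGpriv : MM f * MM f ≤ CGpriv f
    MM²≤CGpriv = infimum-greatest (λ p → worstInverse f (collision f p)) bound
      where
      bound : ∀ p r → worstInverse f (collision f p) ≡ [ r ] → MM f * MM f ≤ r
      bound p r eq = ≤-resp refl (√-square 0≤r) (*-mono-≤ (√-nonNegative 0≤r) MM-nonNegative MM≤√r MM≤√r)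
        where
        0≤r : 0# ≤ r
        0≤r = worstInverse≡⇒nonNegative f (collision f p) (collision-nonNegative p) eq
        MM≤√r : MM f ≤ √ r 0≤r
        MM≤√r = infimum-≤ (λ p → worstInverse f (rootCollision f p)) p
          (worstInverse-≤ f (rootCollision f p) (rootCollision-nonNegative p) (√-nonNegative 0≤r) λ x y →
            1≤√* 0≤r (rootCollision-nonNegative p x y)
              (≤-worstInverse f (collision f p) (collision-nonNegative p) eq x y)
              (collision≤rootCollision² p x y))

    -- The collision sum of `w` is `sum (w x) * sum (w y)` times that of the normalised strategy, so
    -- normalising loses at most the factor `a * b`. Both the expectational weights and the
    -- certificate indicators are fed into this.
    CGpriv-≤-weights : ∀ {a b} (w : Input n → Fin n → Carrier) → (∀ z i → 0# ≤ w z i) →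
      0# ≤ a → 0# ≤ b →
      (∀ x → f x ≡ false → sum (w x) ≤ a) → (∀ y → f y ≡ true → sum (w y) ≤ b) →
      (∀ x y → f x ≡ false → f y ≡ true → 1# ≤ sumDiffer x y (λ i → w x i * w y i)) →
      CGpriv f ≤ a * b
    CGpriv-≤-weights {a} {b} w 0≤w 0≤a 0≤b w≤a w≤b 1≤w = CGpriv-≤ p (*-nonNegative 0≤a 0≤b) 1≤abc
      where
      p : PrivateStrategy f
      p z = proj₁ (normalise (w z) (0≤w z))
      1≤abc : ∀ x y → 1# ≤ (a * b) * collision f p x y
      1≤abc X@(x , fx) Y@(y , fy) = ≤-trans (1≤w x y fx fy) (≤-trans (≤-reflexive w≈)
        (*-monoˡ-≤ (collision-nonNegative p X Y)
          (*-mono-≤ 0≤a (sum-nonNegative (0≤w y)) (w≤a x fx) (w≤b y fy))))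
        where
        w≈ : sumDiffer x y (λ i → w x i * w y i) ≈ (sum (w x) * sum (w y)) * collision f p X Y
        w≈ = trans
          (filteredSum-cong (differ? x y) λ i → trans
            (*-cong (proj₂ (normalise (w x) (0≤w x)) i) (proj₂ (normalise (w y) (0≤w y)) i))
            (solve 4 (λ s t u v → (s :* u) :* (t :* v) := (s :* t) :* (u :* v)) refl _ _ _ _))
          (sym (*-distribˡ-filteredSum (differ? x y) _ _))

    CGpriv≤EC² : CGpriv f ≤ 1# * (EC f * EC f)
    CGpriv≤EC² = infimum-square (λ W → worstCase f (totalWeight f W))
      (λ {W} → worstCase≡⇒nonNegative f (totalWeight f W)) CGpriv-nonNegative 0≤1 λ W r eq →
      let 0≤r = worstCase≡⇒nonNegative f (totalWeight f W) eq
          open ECWeights W using (w; feasible)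
      in ≤-resp refl (sym (*-identityˡ (r * r)))
        (CGpriv-≤-weights w (ECWeights.nonNegative W) 0≤r 0≤r
          (λ x _ → ≤-worstCase f (totalWeight f W) eq x)
          (λ y _ → ≤-worstCase f (totalWeight f W) eq y)
          (λ x y fx fy → feasible x y (≡.trans fx (≡.sym (≡.cong not fy)))))

    indicator : PartialAssignment n → Fin n → Carrier
    indicator ρ i = if is-just (lookup ρ i) then 1# else 0#

    CGpriv≤C⁰C¹ : CGpriv f ≤ fromℕ (certificateComplexity false f) * fromℕ (certificateComplexity true f)
    CGpriv≤C⁰C¹ = CGpriv-≤-weights (λ z → indicator (cert z)) (λ z → 0≤indicator (cert z))
      (0≤fromℕ (certificateComplexity false f)) (0≤fromℕ (certificateComplexity true f)) bound bound meet
      where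
      cert : Input n → PartialAssignment n
      cert z = proj₁ (smallCertificate f z)
      0≤indicator : ∀ ρ i → 0# ≤ indicator ρ i
      0≤indicator ρ i with is-just (lookup ρ i)
      ... | true  = 0≤1
      ... | false = ≤-refl
      sum-indicator : ∀ {n} (ρ : PartialAssignment n) →
                      sum (λ i → if is-just (lookup ρ i) then 1# else 0#) ≈ fromℕ (size ρ)
      sum-indicator []            = refl
      sum-indicator (just _  ∷ ρ) = +-congˡ (sum-indicator ρ)
      sum-indicator (nothing ∷ ρ) = trans (+-identityˡ _) (sum-indicator ρ)
      bound : ∀ {b} x → f x ≡ b → sum (indicator (cert x)) ≤ fromℕ (certificateComplexity b f)
      bound x fx≡b = ≤-trans (≤-reflexive (sum-indicator (cert x)))
        (fromℕ-mono-≤ (ℕ.≤-trans (proj₂ (proj₂ (smallCertificate f x)))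
                                 (certificateAt≤certificateComplexity f fx≡b)))
      meet : ∀ x y → f x ≡ false → f y ≡ true →
             1# ≤ sumDiffer x y (λ i → indicator (cert x) i * indicator (cert y) i)
      meet x y fx fy =
        let (i , ρi , σi , xi≢yi) = certificates-conflict f {ρ = cert x} {σ = cert y}
              (preimages-≢ f (x , fx) (y , fy))
              (proj₁ (proj₂ (smallCertificate f x))) (proj₁ (proj₂ (smallCertificate f y)))
        -- At the conflicting bit both indicators are 1, so this single term suffices.
        in ≤-trans (≤-reflexive (sym (trans
             (*-cong (reflexive (≡.cong (λ b → if b then 1# else 0#) ρi))
                     (reflexive (≡.cong (λ b → if b then 1# else 0#) σi)))
             (*-identityˡ 1#))))
           (term≤filteredSum (differ? x y) _
             (λ i → *-nonNegative (0≤indicator (cert x) i) (0≤indicator (cert y) i)) i xi≢yi)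

  -- Public coin strategies: marginals and sensitivity

  module _ (d : Distribution m) (g : Fin m → Fin n) where

    private
      mass : Fin n → Carrier
      mass i = filteredSum (λ k → g k Fin.≟ i) (prob d)

    -- Once the two sums are exchanged, each `k` contributes only at the index `g k`.
    filteredSum-pushforward : {P : Pred (Fin n) 0ℓ} (P? : ∀ i → Dec (P i)) →
                              filteredSum P? mass ≈ filteredSum (P? ∘ g) (prob d)
    filteredSum-pushforward P? = trans
      (sum-cong λ i → if-sum (does (P? i)) (λ k → if does (g k Fin.≟ i) then prob d k else 0#))
      (trans (∑-comm term) (sum-cong λ k → trans (sum-single (g k) (off k)) (on k)))
      where
      term : Fin n → Fin m → Carrier
      term i k = if does (P? i) then (if does (g k Fin.≟ i) then prob d k else 0#) else 0#
      off : ∀ k i → i ≢ g k → term i k ≈ 0#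
      off k i i≢gk with does (P? i) | g k Fin.≟ i
      ... | false | _        = refl
      ... | true  | no _     = refl
      ... | true  | yes gk≡i = contradiction (≡.sym gk≡i) i≢gk
      on : ∀ k → term (g k) k ≈ (if does (P? (g k)) then prob d k else 0#)
      on k rewrite Dec.dec-true (g k Fin.≟ g k) ≡.refl = refl

    pushforward : Distribution n
    pushforward = record
      { prob        = mass
      ; nonNegative = λ i → filteredSum-nonNegative (λ k → g k Fin.≟ i) (nonNegative d)
      -- The total mass is the case of a predicate that always holds.
      ; total       = trans (filteredSum-pushforward (λ _ → yes tt)) (total d)
      }

  module _ .{{_ : NonZero n}} (f : BoolFun n) where

    module _ (q : PrivateStrategy f) {r} (0≤r : 0# ≤ r)
             (cover : ∀ x z → f z ≢ f x → 1# ≤ r * sumDiffer x z (prob (q x))) where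

      private
        S = fromℕ (sensitivity f)

      -- By minimality each bit of the block is sensitive for the far end `z`, so the block is
      -- counted by the sensitivity at `z`.
      minimalBlock-size : ∀ {x z} → MinimalBlock f x z → filteredSum (differ? x z) (λ _ → 1#) ≤ S
      minimalBlock-size {x} {z} (_ , sensitive) = ≤-trans
        (filteredSum-mono-≤ (differ? x z) (λ i → f (z [ i ]%= not) Bool.≟ not (f z))
          (λ _ → 0≤1) (λ i d → sensitive i d , ≤-refl))
        (≤-trans
          (≤-reflexive (sym (length-filter-tabulate (λ i → f (z [ i ]%= not) Bool.≟ not (f z)) (λ i → i))))
          (fromℕ-mono-≤ (sensitivityAt≤sensitivity f z)))

      block-collision : ∀ {x y z} → MinimalBlock f x z →
        (∀ i → Differ x z i → Differ x y i × prob (q x) i ≤ prob (q y) i) →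
        1# ≤ (S * (r * r)) * sumDiffer x y (λ i → prob (q x) i * prob (q y) i)
      block-collision {x} {y} {z} min sub = ≤-trans
        -- Applied to `r * prob (q x) i`, whose sum over the block is at least 1 by `cover`.
        (cauchySchwarz (differ? x z) (minimalBlock-size min) 1≤S
          (≤-trans (cover x z (proj₁ min)) (≤-reflexive (*-distribˡ-filteredSum (differ? x z) r (prob (q x))))))
        (≤-resp refl (sym (*-assoc S (r * r) _)) (*-monoʳ-≤ (0≤fromℕ (sensitivity f))
          (≤-trans
            (filteredSum-mono-≤ (differ? x z) (differ? x y)
              (λ i → *-nonNegative 0≤rr (0≤p*q f q x y i))
              (λ i d → proj₁ (sub i d) , ≤-trans (≤-reflexive (square i))
                (*-monoʳ-≤ 0≤rr (*-monoʳ-≤ (nonNegative (q x) i) (proj₂ (sub i d))))))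
            (≤-reflexive (sym (*-distribˡ-filteredSum (differ? x y) (r * r) _))))))
        where
        0≤rr : 0# ≤ r * r
        0≤rr = *-nonNegative 0≤r 0≤r
        1≤S : 1# ≤ S
        -- The block is nonempty because its two ends have different values.
        1≤S = let (i , d) = separated f (proj₁ min ∘ ≡.sym) in
          ≤-trans (term≤filteredSum (differ? x z) (λ _ → 1#) (λ _ → 0≤1) i d) (minimalBlock-size min)
        square : ∀ i → (r * prob (q x) i) * (r * prob (q x) i) ≈ (r * r) * (prob (q x) i * prob (q x) i)
        square i = solve 2 (λ r a → (r :* a) :* (r :* a) := (r :* r) :* (a :* a)) refl r (prob (q x) i)

      covering-collision : ∀ x y → f x ≢ f y →
        1# ≤ (S * (r * r)) * sumDiffer x y (λ i → prob (q x) i * prob (q y) i)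
      covering-collision x y fx≢fy
        with splitBlock f (λ i → prob (q x) i ≤? prob (q y) i) x y fx≢fy
      ... | inj₁ (z , min , sub) = block-collision min sub
      ... | inj₂ (z , min , sub) = ≤-trans
        -- The same argument with the roles of `x` and `y` exchanged: off the chosen set `q y` is
        -- the smaller one.
        (block-collision min λ i d → let (yi≢xi , qx≰qy) = sub i d in yi≢xi , ≰⇒≥ qx≰qy)
        (*-monoʳ-≤ (*-nonNegative (0≤fromℕ (sensitivity f)) (*-nonNegative 0≤r 0≤r))
          (collision-swap f q y x))
        where
        ≰⇒≥ : ∀ {a b} → ¬ a ≤ b → b ≤ a
        ≰⇒≥ {a} {b} a≰b with ≤-total a b
        ... | inj₁ a≤b = contradiction a≤b a≰b
        ... | inj₂ b≤a = b≤a

    -- The value is a separate argument so that matching on it decides which of the two players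
    -- replies to `z`.
    answer : ∀ z b → f z ≡ b → DeterministicStrategy f → Fin n
    answer z false fz≡0 (A , _) = A (z , fz≡0)
    answer z true  fz≡1 (_ , B) = B (z , fz≡1)

    answer-cong : ∀ z {b c} (fz≡b : f z ≡ b) (fz≡c : f z ≡ c) AB →
                  answer z b fz≡b AB ≡ answer z c fz≡c AB
    answer-cong z ≡.refl ≡.refl AB = ≡.refl

    module _ (p : Random (DeterministicStrategy f)) where

      reply : Input n → Fin (support p) → Fin n
      reply z k = answer z (f z) ≡.refl (outcome p k)

      marginal : PrivateStrategy f
      marginal z = pushforward (law p) (reply z)

      -- Whenever the players win, the bit named on `x` is one where `x` and `y` differ.
      winProbability≤marginalˡ : ∀ X Y →
        winProbability f p X Y ≤ sumDiffer (proj₁ X) (proj₁ Y) (prob (marginal (proj₁ X)))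
      winProbability≤marginalˡ (x , fx) (y , fy) = ≤-trans
        (filteredSum-mono-≤ (λ k → correct? f (x , fx) (y , fy) (outcome p k)) (differ? x y ∘ reply x)
          (nonNegative (law p)) λ { k (_ , d) →
            ≡.subst (Differ x y) (answer-cong x fx ≡.refl (outcome p k)) d , ≤-refl })
        (≤-reflexive (sym (filteredSum-pushforward (law p) (reply x) (differ? x y))))

      winProbability≤marginalʳ : ∀ X Y →
        winProbability f p X Y ≤ sumDiffer (proj₁ Y) (proj₁ X) (prob (marginal (proj₁ Y)))
      winProbability≤marginalʳ (x , fx) (y , fy) = ≤-trans
        (filteredSum-mono-≤ (λ k → correct? f (x , fx) (y , fy) (outcome p k)) (differ? y x ∘ reply y)
          (nonNegative (law p)) λ { k (A≡B , d) →
            ≡.subst (Differ y x) (≡.trans A≡B (answer-cong y fy ≡.refl (outcome p k))) (d ∘ ≡.sym) ,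
            ≤-refl })
        (≤-reflexive (sym (filteredSum-pushforward (law p) (reply y) (differ? y x))))

      marginal-covers : ∀ {r} → 0# ≤ r → (∀ x y → 1# ≤ r * winProbability f p x y) →
                        ∀ x z → f z ≢ f x → 1# ≤ r * sumDiffer x z (prob (marginal x))
      marginal-covers {r} 0≤r 1≤rw x z fz≢fx = go (f x) (f z) ≡.refl ≡.refl
        where
        go : ∀ b c → f x ≡ b → f z ≡ c → 1# ≤ r * sumDiffer x z (prob (marginal x))
        go false false fx fz = contradiction (≡.trans fz (≡.sym fx)) fz≢fx
        go false true  fx fz = ≤-trans (1≤rw (x , fx) (z , fz))
          (*-monoʳ-≤ 0≤r (winProbability≤marginalˡ (x , fx) (z , fz)))
        go true  false fx fz = ≤-trans (1≤rw (z , fz) (x , fx))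
          (*-monoʳ-≤ 0≤r (winProbability≤marginalʳ (z , fz) (x , fx)))
        go true  true  fx fz = contradiction (≡.trans fz (≡.sym fx)) fz≢fx

    CGpriv≤s*CGpub² : CGpriv f ≤ fromℕ (sensitivity f) * (CGpub f * CGpub f)
    CGpriv≤s*CGpub² = infimum-square (λ p → worstInverse f (winProbability f p))
      (λ {p} → worstInverse≡⇒nonNegative f (winProbability f p) (winProbability-nonNegative f p))
      (CGpriv-nonNegative f) (0≤fromℕ (sensitivity f)) λ p r eq →
        let 0≤r = worstInverse≡⇒nonNegative f (winProbability f p) (winProbability-nonNegative f p) eq
            1≤rw = ≤-worstInverse f (winProbability f p) (winProbability-nonNegative f p) eq
        in CGpriv-≤ f (marginal p) (*-nonNegative (0≤fromℕ (sensitivity f)) (*-nonNegative 0≤r 0≤r))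
             λ x y → covering-collision (marginal p) 0≤r (marginal-covers p 0≤r 1≤rw)
                       (proj₁ x) (proj₁ y) (preimages-≢ f x y)

  -- Averages and mixtures of random outcomes

  sum-++ : ∀ {A : Set} (h : A → Carrier) (xs : Vector A m) (ys : Vector A n) →
           sum (h ∘ (xs Vector.++ ys)) ≈ sum (h ∘ xs) + sum (h ∘ ys)
  sum-++ {m = zero}  h xs ys = sym (+-identityˡ _)
  sum-++ {m = suc m} h xs ys = begin
    h (xs zero) + sum (λ i → h ((xs Vector.++ ys) (suc i)))
      ≈⟨ +-congˡ (sum-cong λ i → reflexive (≡.cong h (Sum.[,]-map (splitAt m i)))) ⟩
    h (xs zero) + sum (h ∘ ((xs ∘ suc) Vector.++ ys))        ≈⟨ +-congˡ (sum-++ h (xs ∘ suc) ys) ⟩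
    h (xs zero) + (sum (h ∘ xs ∘ suc) + sum (h ∘ ys))        ≈⟨ +-assoc _ _ _ ⟨
    h (xs zero) + sum (h ∘ xs ∘ suc) + sum (h ∘ ys)          ∎

  average : Distribution n → Vector Carrier n → Carrier
  average {n} d v = ∑[ i < n ] (prob d i * v i)

  module _ (d : Distribution n) where

    average-cong : {u v : Vector Carrier n} → (∀ i → u i ≈ v i) → average d u ≈ average d v
    average-cong u≈v = sum-cong λ i → *-congˡ (u≈v i)

    average-mono-≤ : {u v : Vector Carrier n} → (∀ i → u i ≤ v i) → average d u ≤ average d v
    average-mono-≤ u≤v = sum-mono-≤ λ i → *-monoʳ-≤ (nonNegative d i) (u≤v i)

    average-const : ∀ c → average d (λ _ → c) ≈ c
    average-const c = trans (sym (*-distribʳ-sum c (prob d))) (trans (*-congʳ (total d)) (*-identityˡ c))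

    average-+ : (u v : Vector Carrier n) → average d (λ i → u i + v i) ≈ average d u + average d v
    average-+ u v = trans (sum-cong λ i → distribˡ (prob d i) (u i) (v i))
                          (∑-distrib-+ (λ i → prob d i * u i) (λ i → prob d i * v i))

    average-+-const : ∀ c (v : Vector Carrier n) → average d (λ i → c + v i) ≈ c + average d v
    average-+-const c v = trans (average-+ (λ _ → c) v) (+-congʳ (average-const c))

    average-* : ∀ c (v : Vector Carrier n) → average d (λ i → c * v i) ≈ c * average d v
    average-* c v = trans
      (sum-cong λ i → solve 3 (λ p c v → p :* (c :* v) := c :* (p :* v)) refl (prob d i) c (v i))
      (sym (*-distribˡ-sum c (λ i → prob d i * v i)))

  -- The weights of a vector of atoms need not add up to 1, so a mixture can be assembled by
  -- concatenating its scaled components one at a time.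
  Atom : Set → Set
  Atom A = ∃ (0# ≤_) × A

  scale : ∀ {A} (a : Carrier) → 0# ≤ a → (X : Random A) → Vector (Atom A) (support X)
  scale a 0≤a X k = (a * prob (law X) k , *-nonNegative 0≤a (nonNegative (law X) k)) , outcome X k

  weigh : ∀ {A} → (A → Carrier) → Atom A → Carrier
  weigh g ((a , _) , x) = a * g x

  sum-scale : ∀ {A} (a : Carrier) 0≤a (X : Random A) g →
              sum (weigh g ∘ scale a 0≤a X) ≈ a * expectation X g
  sum-scale a 0≤a X g = trans
    (sum-cong λ k → *-assoc a (prob (law X) k) (g (outcome X k)))
    (sym (*-distribˡ-sum a (λ k → prob (law X) k * g (outcome X k))))

  atoms : ∀ {A} (w : Vector (∃ (0# ≤_)) m) → (Fin m → Random A) → ∃ (Vector (Atom A))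
  atoms {m = zero}  w X = 0 , λ ()
  atoms {m = suc m} w X = let (a , 0≤a) = w zero in
    _ , scale a 0≤a (X zero) Vector.++ proj₂ (atoms (w ∘ suc) (X ∘ suc))

  sum-atoms : ∀ {A} (w : Vector (∃ (0# ≤_)) m) (X : Fin m → Random A) g →
              sum (weigh g ∘ proj₂ (atoms w X)) ≈ sum (λ i → proj₁ (w i) * expectation (X i) g)
  sum-atoms {m = zero}  w X g = refl
  sum-atoms {m = suc m} w X g = let (a , 0≤a) = w zero in trans
    (sum-++ (weigh g) (scale a 0≤a (X zero)) (proj₂ (atoms (w ∘ suc) (X ∘ suc))))
    (+-cong (sum-scale a 0≤a (X zero) g) (sum-atoms (w ∘ suc) (X ∘ suc) g))

  module _ {A : Set} (d : Distribution m) (X : Fin m → Random A) where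

    private
      w : Vector (∃ (0# ≤_)) m
      w i = prob d i , nonNegative d i

      v : Vector (Atom A) (proj₁ (atoms w X))
      v = proj₂ (atoms w X)

    mixture : Random A
    mixture = record
      { law     = record
        { prob        = proj₁ ∘ proj₁ ∘ v
        ; nonNegative = proj₂ ∘ proj₁ ∘ v
        -- The total mass is the weighted sum of the constant function 1.
        ; total       = begin
            sum (proj₁ ∘ proj₁ ∘ v)
              ≈⟨ sum-cong (λ k → sym (*-identityʳ (proj₁ (proj₁ (v k))))) ⟩
            sum (weigh (λ _ → 1#) ∘ v)
              ≈⟨ sum-atoms w X (λ _ → 1#) ⟩
            average d (λ i → expectation (X i) (λ _ → 1#))
              ≈⟨ average-cong d (λ i → average-const (law (X i)) 1#) ⟩
            average d (λ _ → 1#)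
              ≈⟨ average-const d 1# ⟩
            1#                                                ∎
        }
      ; outcome = proj₂ ∘ v
      }

    expectation-mixture : ∀ g → expectation mixture g ≈ average d (λ i → expectation (X i) g)
    expectation-mixture = sum-atoms w X

  always : ∀ {A : Set} → A → Random A
  always a = record { law = uniform 1 ; outcome = λ _ → a }

  expectation-always : ∀ {A : Set} (a : A) g → expectation (always a) g ≈ g a
  expectation-always a g = average-const (uniform 1) (g a)

  -- Randomised trees below a partial assignment

  module _ (f : BoolFun n) where

    -- What a subtree must guarantee once the answers recorded in `ρ` have been received.
    record TreeOn (ρ : PartialAssignment n) : Set where
      constructor _,_
      field
        tree    : DecisionTree n
        correct : ∀ x → Consistent ρ x → eval tree x ≡ f x

    open TreeOn public

    cost : ∀ {ρ} → Random (TreeOn ρ) → Input n → Carrier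
    cost T x = expectation T λ t → fromℕ (queries (tree t) x)

    module _ {ρ : PartialAssignment n} (i : Fin n) where

      nodeOn : TreeOn (ρ [ i ]≔ just false) → TreeOn (ρ [ i ]≔ just true) → TreeOn ρ
      nodeOn t₀ t₁ = node i (tree t₀) (tree t₁) , evaluates
        where
        evaluates : ∀ x → Consistent ρ x → eval (node i (tree t₀) (tree t₁)) x ≡ f x
        evaluates x x∈ρ with lookup x i | consistent-update ρ x i x∈ρ
        ... | false | x∈ρ′ = correct t₀ x x∈ρ′
        ... | true  | x∈ρ′ = correct t₁ x x∈ρ′

      module _ (T : ∀ b → Random (TreeOn (ρ [ i ]≔ just b))) where

        -- The two subtrees are drawn independently, which makes every outcome a complete
        -- deterministic tree.
        branch : Random (TreeOn ρ)
        branch = mixture (law (T false)) λ k → record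
          { law     = law (T true)
          ; outcome = λ l → nodeOn (outcome (T false) k) (outcome (T true) l)
          }

        -- Only the subtree selected by bit `i` of `x` is entered, and averaging over the draw of
        -- the other one changes nothing.
        cost-branch : ∀ x → cost branch x ≈ 1# + cost (T (lookup x i)) x
        cost-branch x = trans
          (expectation-mixture (law (T false)) (λ k → record
            { law     = law (T true)
            ; outcome = λ l → nodeOn (outcome (T false) k) (outcome (T true) l)
            }) (λ t → fromℕ (queries (tree t) x)))
          (byAnswer (lookup x i))
          where
          q₀ : Fin (support (T false)) → ℕ
          q₀ k = queries (tree (outcome (T false) k)) x
          q₁ : Fin (support (T true)) → ℕ
          q₁ l = queries (tree (outcome (T true) l)) x
          byAnswer : ∀ b →
            average (law (T false)) (λ k → average (law (T true)) λ l → 1# + fromℕ (if b then q₁ l else q₀ k))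
            ≈ 1# + cost (T b) x
          byAnswer false = trans
            (average-cong (law (T false)) λ k → average-const (law (T true)) (1# + fromℕ (q₀ k)))
            (average-+-const (law (T false)) 1# (fromℕ ∘ q₀))
          byAnswer true  = trans
            (average-cong (law (T false)) λ k → average-+-const (law (T true)) 1# (fromℕ ∘ q₁))
            (average-const (law (T false)) (1# + cost (T true) x))

  -- The query algorithm and its potential

  1+1≉0 : 1# + 1# ≉ 0#
  1+1≉0 = 1≤⇒≉0 (x≤x+y 0≤1)

  0≤1+1 : 0# ≤ 1# + 1#
  0≤1+1 = 0≤+ 0≤1 0≤1

  half : Carrier
  half = proj₁ (inverse (1# + 1#) 1+1≉0)

  0≤half : 0# ≤ half
  0≤half = inverse-nonNegative 0≤1+1 (proj₂ (inverse (1# + 1#) 1+1≉0))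

  midpoint : Distribution n → Distribution n → Distribution n
  midpoint d e = record
    { prob        = λ i → half * (prob d i + prob e i)
    ; nonNegative = λ i → *-nonNegative 0≤half (0≤+ (nonNegative d i) (nonNegative e i))
    ; total       = begin
        sum (λ i → half * (prob d i + prob e i))  ≈⟨ *-distribˡ-sum half (λ i → prob d i + prob e i) ⟨
        half * sum (λ i → prob d i + prob e i)    ≈⟨ *-congˡ (∑-distrib-+ (prob d) (prob e)) ⟩
        half * (sum (prob d) + sum (prob e))      ≈⟨ *-congˡ (+-cong (total d) (total e)) ⟩
        half * (1# + 1#)                          ≈⟨ *-comm half (1# + 1#) ⟩
        (1# + 1#) * half                          ≈⟨ proj₂ (inverse (1# + 1#) 1+1≉0) ⟩
        1#                                        ∎
    }

  average-midpoint : (d e : Distribution n) (v : Vector Carrier n) →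
                     average (midpoint d e) v ≈ half * (average d v + average e v)
  average-midpoint d e v = trans
    (sum-cong λ i → solve 4 (λ h a b c → (h :* (a :+ b)) :* c := h :* (a :* c :+ b :* c)) refl
                      half (prob d i) (prob e i) (v i))
    (trans (sym (*-distribˡ-sum half (λ i → prob d i * v i + prob e i * v i)))
           (*-congˡ (∑-distrib-+ (λ i → prob d i * v i) (λ i → prob e i * v i))))

  module _ .{{_ : NonZero n}} (f : BoolFun n) (p : PrivateStrategy f) where

    -- The strategy may draw a bit that it has queried before; such a bit has weight zero here, so
    -- repeating it leaves the potential `mass` unchanged.
    fresh : PartialAssignment n → Input n → Vector Carrier n
    fresh ρ z i = if is-just (lookup ρ i) then 0# else prob (p z) i

    mass : PartialAssignment n → Input n → Carrier
    mass ρ z = sum (fresh ρ z)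

    fresh-nonNegative : ∀ ρ z i → 0# ≤ fresh ρ z i
    fresh-nonNegative ρ z i with is-just (lookup ρ i)
    ... | true  = ≤-refl
    ... | false = nonNegative (p z) i

    mass-nonNegative : ∀ ρ z → 0# ≤ mass ρ z
    mass-nonNegative ρ z = sum-nonNegative (fresh-nonNegative ρ z)

    mass≤1 : ∀ ρ z → mass ρ z ≤ 1#
    mass≤1 ρ z = ≤-trans (sum-mono-≤ λ i → fresh≤prob i (is-just (lookup ρ i))) (≤-reflexive (total (p z)))
      where
      fresh≤prob : ∀ i b → (if b then 0# else prob (p z) i) ≤ prob (p z) i
      fresh≤prob i true  = nonNegative (p z) i
      fresh≤prob i false = ≤-refl

    mass-update : ∀ ρ z i b → mass ρ z ≈ fresh ρ z i + mass (ρ [ i ]≔ just b) z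
    mass-update ρ z i b = sum-extract i
      (λ k k≢i → reflexive (≡.cong (λ m → if is-just m then 0# else prob (p z) k)
                   (≡.sym (lookup∘updateAt′ k i k≢i ρ))))
      (reflexive (≡.cong (λ m → if is-just m then 0# else prob (p z) i) (lookup∘updateAt i ρ)))

    -- Two inputs consistent with ρ can only differ at a bit that ρ leaves free.
    sumDiffer≤average-fresh : ∀ ρ x z → Consistent ρ x → Consistent ρ z →
      sumDiffer x z (λ i → prob (p x) i * prob (p z) i) ≤ average (p x) (fresh ρ z)
    sumDiffer≤average-fresh ρ x z x∈ρ z∈ρ = sum-mono-≤ λ i →
      pointwise i (lookup ρ i) ≡.refl (differ? x z i)
      where
      pointwise : ∀ i m → lookup ρ i ≡ m → (d : Dec (Differ x z i)) →
        (if does d then prob (p x) i * prob (p z) i else 0#)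
        ≤ prob (p x) i * (if is-just m then 0# else prob (p z) i)
      pointwise i nothing  eq (yes _) = ≤-refl
      pointwise i nothing  eq (no _)  = 0≤p*q f p x z i
      pointwise i (just b) eq (yes d) = contradiction (≡.trans (x∈ρ i b eq) (≡.sym (z∈ρ i b eq))) d
      pointwise i (just b) eq (no _)  = ≤-reflexive (sym (zeroʳ _))

    module _ {r} (0≤r : 0# ≤ r) (1≤rc : ∀ X Y → 1# ≤ r * collision f p X Y) where

      private
        R : Carrier
        -- One factor 2 makes up for the midpoint, since only one of the two inputs drawn upon is
        -- guaranteed to help. The other makes the expected drop 2, which pays for one query and one
        -- round.
        R = ((1# + 1#) * (1# + 1#)) * r

        0≤R : 0# ≤ R
        0≤R = *-nonNegative (*-nonNegative 0≤1+1 0≤1+1) 0≤r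

        N : ℕ
        -- Both the number of rounds and a bound on the cost of querying everything, so that it
        -- cancels in the end.
        N = depth (proj₁ (fullTree f))

      2≤R*half : ∀ {c} → 1# ≤ r * c → 1# + 1# ≤ R * (half * c)
      2≤R*half {c} 1≤rc = ≤-resp (*-identityʳ _) eq (*-monoʳ-≤ 0≤1+1 1≤rc)
        where
        eq : (1# + 1#) * (r * c) ≈ R * (half * c)
        eq = begin
          (1# + 1#) * (r * c)                          ≈⟨ *-identityˡ _ ⟨
          1# * ((1# + 1#) * (r * c))                   ≈⟨ *-congʳ (proj₂ (inverse (1# + 1#) 1+1≉0)) ⟨
          ((1# + 1#) * half) * ((1# + 1#) * (r * c))
            ≈⟨ solve 4 (λ t h r c → (t :* h) :* (t :* (r :* c)) := ((t :* t) :* r) :* (h :* c)) refl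
                 (1# + 1#) half r c ⟩
          R * (half * c)                               ∎

      -- One of `x` and `y` has a value other than `f z`, and its collision sum with `z` lives on
      -- bits free in `ρ`. The average for the other input is dropped as nonnegative.
      progress : ∀ ρ x y z → f x ≡ false → f y ≡ true →
                 Consistent ρ x → Consistent ρ y → Consistent ρ z →
                 1# + 1# ≤ R * average (midpoint (p x) (p y)) (fresh ρ z)
      progress ρ x y z fx fy x∈ρ y∈ρ z∈ρ = ≤-resp refl
        (*-congˡ (sym (average-midpoint (p x) (p y) (fresh ρ z)))) (byValue (f z) ≡.refl)
        where
        0≤avg : ∀ d → 0# ≤ average d (fresh ρ z)
        0≤avg d = sum-nonNegative λ i → *-nonNegative (nonNegative d i) (fresh-nonNegative ρ z i)
        byValue : ∀ b → f z ≡ b →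
          1# + 1# ≤ R * (half * (average (p x) (fresh ρ z) + average (p y) (fresh ρ z)))
        byValue true  fz = ≤-trans (2≤R*half (1≤rc (x , fx) (z , fz)))
          (*-monoʳ-≤ 0≤R (*-monoʳ-≤ 0≤half
            (≤-trans (sumDiffer≤average-fresh ρ x z x∈ρ z∈ρ) (x≤x+y (0≤avg (p y))))))
        byValue false fz = ≤-trans (2≤R*half (1≤rc (z , fz) (y , fy)))
          (*-monoʳ-≤ 0≤R (*-monoʳ-≤ 0≤half
            (≤-trans (collision-swap f p z y)
            (≤-trans (sumDiffer≤average-fresh ρ y z y∈ρ z∈ρ)
            (≤-resp refl (+-comm _ _) (x≤x+y (0≤avg (p x))))))))

      Bounded : ℕ → ∀ {ρ} → Random (TreeOn f ρ) → Set
      Bounded k {ρ} T = ∀ z → Consistent ρ z → cost f T z + fromℕ k ≤ R * mass ρ z + fromℕ N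

      -- A leaf costs nothing, so the bound follows from `k ≤ N` and the nonnegativity of the
      -- potential.
      constant-bounded : ∀ k ρ b → k ℕ.≤ N → (∀ z → Consistent ρ z → f z ≡ b) →
                         ∃ (Bounded k {ρ})
      constant-bounded k ρ b k≤N f≡b = T , λ z _ → ≤-trans
        (≤-reflexive (trans (+-congʳ (expectation-always leafOn λ t → fromℕ (queries (tree t) z)))
                            (+-identityˡ (fromℕ k))))
        (≤-trans (fromℕ-mono-≤ k≤N)
          (≤-resp refl (+-comm _ _) (x≤x+y (*-nonNegative 0≤R (mass-nonNegative ρ z)))))
        where
        leafOn : TreeOn f ρ
        leafOn = leaf b , λ z z∈ρ → ≡.sym (f≡b z z∈ρ)
        T = always leafOn

      -- The potential argument: with k rounds left and N the cost of giving up and querying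
      -- everything, a round costs 1, lowers k by 1, and lowers R·mass by at least 2 on average.
      strategy : ∀ k → k ℕ.≤ N → ∀ ρ → ∃ (Bounded k {ρ})
      strategy zero    _     ρ = always full , λ z _ → ≤-trans
        (≤-reflexive (trans (+-identityʳ _) (expectation-always full λ t → fromℕ (queries (tree t) z))))
        (≤-trans (fromℕ-mono-≤ (queries≤depth (proj₁ (fullTree f)) z))
          (≤-resp refl (+-comm _ _) (x≤x+y (*-nonNegative 0≤R (mass-nonNegative ρ z)))))
        where
        full : TreeOn f ρ
        full = proj₁ (fullTree f) , λ x _ → proj₂ (fullTree f) x
      strategy (suc k) 1+k≤N ρ
        with findInput? (λ x → consistent? ρ x ×-dec f x Bool.≟ false)
           | findInput? (λ x → consistent? ρ x ×-dec f x Bool.≟ true)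
      ... | no none | _       = constant-bounded (suc k) ρ true 1+k≤N
                                  λ z z∈ρ → Bool.¬-not λ fz → none (z , z∈ρ , fz)
      ... | _       | no none = constant-bounded (suc k) ρ false 1+k≤N
                                  λ z z∈ρ → Bool.¬-not λ fz → none (z , z∈ρ , fz)
      -- The choice of `x` and `y` depends on `ρ` alone; the actual input `z` enters only the
      -- analysis.
      ... | yes (x , x∈ρ , fx) | yes (y , y∈ρ , fy) = T , bound
        where
        q : Distribution n
        q = midpoint (p x) (p y)
        next : ∀ i b → ∃ (Bounded k {ρ [ i ]≔ just b})
        next i b = strategy k (ℕ.≤-trans (ℕ.n≤1+n k) 1+k≤N) (ρ [ i ]≔ just b)
        subtree : ∀ i → Random (TreeOn f ρ)
        subtree i = branch f i (λ b → proj₁ (next i b))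
        T : Random (TreeOn f ρ)
        T = mixture q subtree
        bound : Bounded (suc k) T
        -- `progress` supplies a 2 on the left, which matches on average the 2 on the right of
        -- `step`: one for the query made and one for the round used up.
        bound z z∈ρ = +-cancelˡ-≤ (1# + 1#) (≤-trans
          (+-mono-≤ (progress ρ x y z fx fy x∈ρ y∈ρ z∈ρ) ≤-refl)
          (≤-resp lhs rhs (average-mono-≤ q step)))
          where
          M = R * mass ρ z + fromℕ N
          child : Fin n → Carrier
          child i = cost f (proj₁ (next i (lookup z i))) z
          step : ∀ i → R * fresh ρ z i + (fromℕ (suc k) + (1# + child i)) ≤ (1# + 1#) + M
          step i = ≤-resp
            (solve 4 (λ e k c s → (e :+ e) :+ (s :+ (c :+ k)) := s :+ ((e :+ k) :+ (e :+ c))) refl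
              1# (fromℕ k) (child i) (R * fresh ρ z i))
            (+-congˡ (trans (sym (+-assoc _ _ _)) (+-congʳ (trans (sym (distribˡ R _ _))
              (*-congˡ (sym (mass-update ρ z i (lookup z i))))))))
            (+-monoʳ-≤ (1# + 1#) (+-monoʳ-≤ (R * fresh ρ z i)
              (proj₂ (next i (lookup z i)) z (consistent-update ρ z i z∈ρ))))
          lhs : average q (λ i → R * fresh ρ z i + (fromℕ (suc k) + (1# + child i)))
                ≈ R * average q (fresh ρ z) + (cost f T z + fromℕ (suc k))
          lhs = trans (average-+ q (λ i → R * fresh ρ z i) (λ i → fromℕ (suc k) + (1# + child i)))
            (+-cong (average-* q R (fresh ρ z))
            (trans (average-+-const q (fromℕ (suc k)) (λ i → 1# + child i)) (trans (+-comm _ _) (+-congʳ (sym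
              (trans (expectation-mixture q subtree (λ t → fromℕ (queries (tree t) z)))
                (average-cong q λ i → cost-branch f i (λ b → proj₁ (next i b)) z)))))))
          rhs : average q (λ _ → (1# + 1#) + M) ≈ (1# + 1#) + M
          rhs = average-const q ((1# + 1#) + M)

      R₀-≤ : R₀ f ≤ R
      R₀-≤ = infimum-≤ (λ T → worstCase f (expectedQueries f T)) T
        (worstCase-≤ f (expectedQueries f T) 0≤R bound)
        where
        unknown : PartialAssignment n
        unknown = Vec.replicate n nothing
        consistent-unknown : ∀ x → Consistent unknown x
        consistent-unknown x i b eq with () ← ≡.trans (≡.sym (lookup-replicate i nothing)) eq
        strategyN : ∃ (Bounded N {unknown})
        strategyN = strategy N ℕ.≤-refl unknown
        T : Random (TreeFor f)
        T = record
          { law     = law (proj₁ strategyN)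
          ; outcome = λ k → let t = outcome (proj₁ strategyN) k in
                            tree t , λ x → correct t x (consistent-unknown x)
          }
        bound : ∀ x → expectedQueries f T x ≤ R
        bound x = ≤-trans
          (+-cancelˡ-≤ (fromℕ N) (≤-resp (+-comm _ _) (+-comm _ _)
            (proj₂ strategyN x (consistent-unknown x))))
          (≤-resp refl (*-identityʳ R) (*-monoʳ-≤ 0≤R (mass≤1 unknown x)))

  R₀≤4CGpriv : .{{_ : NonZero n}} (f : BoolFun n) → R₀ f ≤ ((1# + 1#) * (1# + 1#)) * CGpriv f
  R₀≤4CGpriv f = infimum-scale (λ p → worstInverse f (collision f p))
    (*-nonNegative 0≤1+1 0≤1+1) (*-≉0 1+1≉0 1+1≉0) λ p r eq →
    R₀-≤ f p (worstInverse≡⇒nonNegative f (collision f p) (collision-nonNegative f p) eq)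
             (≤-worstInverse f (collision f p) (collision-nonNegative f p) eq)

theorem5p10 :
  (ℛ : CompleteOrderedField) →
  let open CompleteOrderedField ℛ
      open RealProperties ℛ using (fromℕ)
      open Measures ℛ
  in
  ((n : ℕ) .{{_ : NonZero n}} (f : BoolFun n) → MM f * MM f ≤ CGpriv f)
  ×
  ( (∃ λ (K : Carrier) → (n : ℕ) .{{_ : NonZero n}} (f : BoolFun n) →
      R₀ f ≤ K * CGpriv f)
  × (∃ λ (K : Carrier) → (n : ℕ) .{{_ : NonZero n}} (f : BoolFun n) →
      CGpriv f ≤ K * (EC f * EC f)))
  ×
  (∃ λ (K : Carrier) → (n : ℕ) .{{_ : NonZero n}} (f : BoolFun n) →
    CGpriv f ≤ K * ((CGpub f * CGpub f) * fromℕ (sensitivity f)))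
  ×
  ((n : ℕ) .{{_ : NonZero n}} (f : BoolFun n) →
    CGpriv f ≤ fromℕ (certificateComplexity false f) * fromℕ (certificateComplexity true f))
theorem5p10 ℛ =
    (λ n f → MM²≤CGpriv f)
  , ((_ , λ n f → R₀≤4CGpriv f) , (1# , λ n f → CGpriv≤EC² f))
  , (1# , λ n f → ≤-trans (CGpriv≤s*CGpub² f)
      (≤-reflexive (trans (*-comm (fromℕ (sensitivity f)) (CGpub f * CGpub f)) (sym (*-identityˡ _)))))
  , (λ n f → CGpriv≤C⁰C¹ f)
  where
  open CompleteOrderedField ℛ
  open RealProperties ℛ
  open Measures ℛ
  open Bounds ℛ
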